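{- Let $p \geq 5$ be a prime. Let $S(p) = \{ j \in \{0,1,\ldots,p-1\} : j \equiv \tfrac{1}{2} n(3n-1) \pmod p \text{ for some integer } n\}$, let $i_0 \in \{0,1,\ldots,p-1\}$ be such that $i_0 \equiv -1/24 \pmod p$, and let $S^{\ast}(p) = S(p) \setminus \{i_0\}$. If $j \in \{1, 2, \ldots, p-1-\max S^{\ast}(p)\}$, then $$\xi(p^{\lambda} m - j) \equiv 0 \pmod{p^{\lambda}}$$ for all positive integers $m$ and $\lambda$.
   Context: The Fishburn numbers $\xi(n)$, $n \geq 0$, are defined by the identity of formal power series in $q$ $$\sum_{n\geq 0} \xi(n) q^n = \sum_{n \geq 0} \prod_{j=1}^n \bigl(1 - (1-q)^j\bigr),$$ which is well defined since the $n$-th summand is divisible by $q^n$. Here $-1/24$ modulo $p$ means the residue $x$ with $24x \equiv -1 \pmod p$. -}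

module Defs where

open import Data.Nat as ℕ using (ℕ; zero; suc; _∸_; ⌊_/2⌋; _<_)
open import Data.Integer as ℤ using (ℤ; +_; -[1+_])
open import Data.List using (List; []; _∷_; map)
open import Data.Product using (∃-syntax; _×_)
open import Data.Integer.Divisibility using (_∣_)

-- Polynomials over ℤ as coefficient lists (lowest degree first).
Poly : Set
Poly = List ℤ

addP : Poly → Poly → Poly
addP [] ys = ys
addP (x ∷ xs) [] = x ∷ xs
addP (x ∷ xs) (y ∷ ys) = (x ℤ.+ y) ∷ addP xs ys

negP : Poly → Poly
negP = map (λ x → ℤ.- x)

subP : Poly → Poly → Poly
subP xs ys = addP xs (negP ys)

mulP : Poly → Poly → Poly
mulP [] ys = []
mulP (x ∷ xs) ys = addP (map (x ℤ.*_) ys) (+ 0 ∷ mulP xs ys)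

oneP : Poly
oneP = + 1 ∷ []

oneMinusQ : Poly
oneMinusQ = + 1 ∷ ℤ.- (+ 1) ∷ []

powP : Poly → ℕ → Poly
powP f zero = oneP
powP f (suc k) = mulP f (powP f k)

summand : ℕ → Poly
summand zero = oneP
summand (suc k) = mulP (summand k) (subP oneP (powP oneMinusQ (suc k)))

partialSum : ℕ → Poly
partialSum zero = summand zero
partialSum (suc n) = addP (partialSum n) (summand (suc n))

coeff : ℕ → Poly → ℤ
coeff n [] = + 0
coeff zero (x ∷ xs) = x
coeff (suc n) (x ∷ xs) = coeff n xs

-- Fishburn number ξ(n): since summand k is divisible by q^k, only k ≤ n
-- contribute to the coefficient of q^n.
ξ : ℕ → ℤ
ξ n = coeff n (partialSum n)

pent : ℤ → ℕ
pent (+ n) = ⌊ n ℕ.* (3 ℕ.* n ∸ 1) /2⌋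
pent -[1+ m ] = ⌊ suc m ℕ.* (3 ℕ.* suc m ℕ.+ 1) /2⌋

InS : (p : ℕ) → ℕ → Set
InS p j = j < p × ∃[ n ] ((+ p) ∣ (+ j ℤ.- + pent n))

{-# OPTIONS --safe #-}
-- Put z = 1 - q. Modulo p^λ and a power of q, z^M = 1 for a large power M of p, which is odd.
-- For T(x) = Σ (zx; z)_n x^n one has the functional equation
--   (1 - x) T(x) = 1 - z x² - z² x³ (1 - z x) T(z x).
-- Iterating it M times from x = 1 + u with u² = 0 closes up, because z^M = 1, and the
-- coefficient of u is a finite form of Zagier's strange identity:
--   4 Σ (z; z)_n = Σ_{k<M} (-1)^k ((6k+5) z^((k+1)(3k+2)/2) - (6k+1) z^(k(3k+1)/2)).
-- So 4 ξ(n) is congruent to a signed sum of terms a · C(e, n), where e is pentagonal and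
-- a² = 24 e + 1, and every term is divisible by p^λ when n = p^λ m - j. This follows from
-- (i + 1) C(e, i + 1) = (e - i) C(e, i) by descending from i = p^λ m to n: the factors e - i
-- met on the way are prime to p unless e ≡ i₀, in which case p | a and a single factor is
-- divisible by p, but not by p².
module Submission where

open import Defs
open import Algebra.Bundles using (CommutativeRing)
import Algebra.Properties.CommutativeSemiring.Exp
import Algebra.Properties.Ring
import Algebra.Properties.Semiring.Exp
import Algebra.Solver.Ring
open import Algebra.Solver.Ring.AlmostCommutativeRing
  using (fromCommutativeRing; _-Raw-AlmostCommutative⟶_)
open import Data.Integer as ℤ using (ℤ; +_; -[1+_]; ∣_∣)
open import Data.Integer.Divisibility.Signed
  using (∣⇒∣ᵤ; ∣ᵤ⇒∣; ∣m⇒∣-m; ∣m∣n⇒∣m+n; ∣m∣n⇒∣m-n; ∣n⇒∣m*n)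
  renaming (_∣_ to _∣ₛ_; divides to dividesₛ)
import Data.Integer.Properties as ℤₚ
open import Data.Integer.Tactic.RingSolver using (solve-∀)
open import Data.List using ([]; _∷_; map)
open import Data.Maybe using (Maybe; just; nothing)
open import Data.Nat as ℕ using (ℕ; zero; suc; s≤s; z≤n)
open import Data.Nat.Divisibility as ℕᵈ using (divides; divides-refl; _∣?_) renaming (_∣_ to _∣ℕ_)
import Data.Nat.Properties as ℕₚ
open import Data.Nat.Solver using (module +-*-Solver)
open import Data.Product using (∃; _×_; _,_; proj₁; proj₂)
open import Level using (0ℓ)
import Relation.Binary.Reasoning.Setoid
open import Relation.Binary.PropositionalEquality as ≡ using (_≡_; _≢_)
open import Relation.Nullary using (¬_; yes; no; contradiction)
open +-*-Solver using () renaming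
  ( solve to ℕ-solve; con to ℕ-con
  ; _:+_ to infixl 7 _⊕_; _:*_ to infixl 8 _⊗_; _:=_ to infix 4 _⊜_)

-- The strange identity at roots of unity

-- The exponents e with 24 e + 1 = (6k+1)² and (6k+5)², respectively.
pent₁ : ℕ → ℕ
pent₁ zero = 0
pent₁ (suc k) = suc (suc (k ℕ.+ k ℕ.+ k ℕ.+ pent₁ k))

-- Links the recursion, whose increments 3k + 2 are those met when the functional equation is
-- iterated, with the closed form k(3k + 1)/2.
double-pent₁ : ∀ k → pent₁ k ℕ.+ pent₁ k ≡ k ℕ.* (1 ℕ.+ 3 ℕ.* k)
double-pent₁ zero = ≡.refl
double-pent₁ (suc k) = ≡.trans
  (ℕ-solve 2 (λ k x → (ℕ-con 2 ⊕ (k ⊕ k ⊕ k ⊕ x)) ⊕ (ℕ-con 2 ⊕ (k ⊕ k ⊕ k ⊕ x))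
    ⊜ ℕ-con 4 ⊕ ℕ-con 6 ⊗ k ⊕ (x ⊕ x)) ≡.refl k (pent₁ k))
  (≡.trans (≡.cong (4 ℕ.+ 6 ℕ.* k ℕ.+_) (double-pent₁ k))
  (ℕ-solve 1 (λ k → ℕ-con 4 ⊕ ℕ-con 6 ⊗ k ⊕ k ⊗ (ℕ-con 1 ⊕ ℕ-con 3 ⊗ k)
    ⊜ (ℕ-con 1 ⊕ k) ⊗ (ℕ-con 1 ⊕ ℕ-con 3 ⊗ (ℕ-con 1 ⊕ k))) ≡.refl k))

-- For odd m the factor 3m + 1 is even, so m(3m + 1)/2 is a multiple of m. Hence the power of z in
-- `lead u m` is 1 as soon as z^m = 1.
m∣pent₁[m] : ∀ h → suc (h ℕ.+ h) ∣ℕ pent₁ (suc (h ℕ.+ h))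
m∣pent₁[m] h = divides (2 ℕ.+ 3 ℕ.* h) (ℕₚ.*-cancelˡ-≡ _ _ 2 (≡.trans
  (≡.cong (pent₁ m ℕ.+_) (ℕₚ.+-identityʳ (pent₁ m))) (≡.trans (double-pent₁ m)
  (ℕ-solve 1 (λ h → (ℕ-con 1 ⊕ (h ⊕ h)) ⊗ (ℕ-con 1 ⊕ ℕ-con 3 ⊗ (ℕ-con 1 ⊕ (h ⊕ h)))
    ⊜ ℕ-con 2 ⊗ ((ℕ-con 2 ⊕ ℕ-con 3 ⊗ h) ⊗ (ℕ-con 1 ⊕ (h ⊕ h)))) ≡.refl h))))
  where m = suc (h ℕ.+ h)

pent₅ : ℕ → ℕ
pent₅ k = suc (k ℕ.+ k) ℕ.+ pent₁ k

-- The ring stays abstract here; later it consists of truncated polynomials, with z = 1 - q. The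
-- morphism `ι` supplies the integer coefficients of the identity and those of the ring solver.
module StrangeIdentity {ℓ₁ ℓ₂} (R : CommutativeRing ℓ₁ ℓ₂)
  (ι : CommutativeRing.rawRing ℤₚ.+-*-commutativeRing
         -Raw-AlmostCommutative⟶ fromCommutativeRing R)
  (z : CommutativeRing.Carrier R) where

  open CommutativeRing R
  open _-Raw-AlmostCommutative⟶_ ι using (⟦_⟧; +-homo)
  open Algebra.Properties.Semiring.Exp semiring
  open Algebra.Properties.Ring ring using (-0#≈0#; -‿involutive; -‿+-comm) renaming (x≈y⇒x∙y⁻¹≈ε to x≈y⇒x-y≈0)
  open Algebra.Properties.CommutativeSemiring.Exp commutativeSemiring using (^-distrib-*)
  open Relation.Binary.Reasoning.Setoid setoid

  private
    ≈? : ∀ a b → Maybe (⟦ a ⟧ ≈ ⟦ b ⟧)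
    ≈? a b with a ℤ.≟ b
    ... | yes ≡.refl = just refl
    ... | no _ = nothing

  open Algebra.Solver.Ring _ (fromCommutativeRing R) ι ≈? hiding (⟦_⟧)

  -- The functional equation of the truncated series

  sum : ℕ → (ℕ → Carrier) → Carrier
  sum zero f = 0#
  sum (suc n) f = sum n f + f n

  sum-cong : ∀ n {f h} → (∀ i → f i ≈ h i) → sum n f ≈ sum n h
  sum-cong zero eq = refl
  sum-cong (suc n) eq = +-cong (sum-cong n eq) (eq n)

  *-distribˡ-sum : ∀ a n f → a * sum n f ≈ sum n (λ i → a * f i)
  *-distribˡ-sum a zero f = zeroʳ a
  *-distribˡ-sum a (suc n) f = trans (distribˡ a _ _) (+-congʳ (*-distribˡ-sum a n f))

  -- poch x n is (xz; z)_n.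
  poch : Carrier → ℕ → Carrier
  poch x zero = 1#
  poch x (suc n) = poch x n * (1# - z ^ suc n * x)

  T : ℕ → Carrier → Carrier
  T n x = sum n (λ i → poch x i * x ^ i)

  poch-cong : ∀ {x y} → x ≈ y → ∀ n → poch x n ≈ poch y n
  poch-cong x≈y zero = refl
  poch-cong x≈y (suc n) =
    *-cong (poch-cong x≈y n) (+-congˡ (-‿cong (*-congˡ x≈y)))

  T-cong : ∀ n {x y} → x ≈ y → T n x ≈ T n y
  T-cong n x≈y = sum-cong n (λ i → *-cong (poch-cong x≈y i) (^-congˡ i x≈y))

  -- The solver's con (+ 1) denotes ⟦ + 1 ⟧, which need not be definitionally 1#.
  private
    one : ∀ {n} → Polynomial n
    one = con (+ 0) :^ 0

  -- Both sides are the product of 1 - z^i x for 1 ≤ i ≤ n + 1, with the factor i = 1 split off on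
  -- the left.
  poch-shift : ∀ x n → (1# - z * x) * poch (z * x) n ≈ poch x (suc n)
  poch-shift x zero = solve 2 (λ z x →
    (one :- z :* x) :* one := one :* (one :- z :* one :* x)) refl z x
  poch-shift x (suc n) = begin
    (1# - z * x) * (poch (z * x) n * (1# - z ^ suc n * (z * x)))
      ≈⟨ solve 4 (λ z x c y →
           (one :- z :* x) :* (c :* (one :- z :* y :* (z :* x))) :=
           (one :- z :* x) :* c :* (one :- z :* (z :* y) :* x)) refl z x _ (z ^ n) ⟩
    (1# - z * x) * poch (z * x) n * (1# - z ^ suc (suc n) * x)
      ≈⟨ *-congʳ (poch-shift x n) ⟩
    poch x (suc (suc n)) ∎

  private
    -- Discards the higher-order terms once the solver has collected them behind a null factor such
    -- as u * u.
    drop-null : ∀ {x y} a → y ≈ 0# → x + y * a ≈ x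
    drop-null a y≈0 = trans (+-congˡ (trans (*-congʳ y≈0) (zeroˡ a))) (+-identityʳ _)

  -- The error made in the functional equation by keeping only n terms. It vanishes together with
  -- `poch x n`.
  remainder : ℕ → Carrier → Carrier
  remainder n x = x ^ n * ((1# - x) * poch x n + x * poch x (suc n))

  -- Induction on n: the new terms and the change of the remainder add up to a multiple of the
  -- difference of the two sides of `poch-shift`.
  T-functional : ∀ n x →
    (1# - x) * T n x + z * z * (x * x * x) * ((1# - z * x) * T n (z * x)) + remainder n x
    ≈ 1# - z * (x * x)
  T-functional zero x = trans
    -- The empty sum `T 0 x` is `0#`; it enters the solver as the variable o and is dropped
    -- afterwards.
    (solve 3 (λ z x o →
      (one :- x) :* o :+ z :* z :* (x :* x :* x) :* ((one :- z :* x) :* o)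
        :+ one :* ((one :- x) :* one :+ x :* (one :* (one :- z :* one :* x)))
      := one :- z :* (x :* x)
        :+ o :* (one :- x :+ z :* z :* (x :* x :* x) :* (one :- z :* x))) refl z x 0#)
    (drop-null _ refl)
  T-functional (suc n) x = begin
    (1# - x) * (t + c * X)
      + z * z * (x * x * x) * ((1# - z * x) * (t′ + poch (z * x) n * (z * x) ^ n))
      + x * X * ((1# - x) * c′ + x * (c′ * (1# - z ^ suc (suc n) * x)))
      ≈⟨ +-congʳ (+-congˡ (*-congˡ (*-congˡ (+-congˡ (*-congˡ (^-distrib-* z x n)))))) ⟩
    (1# - x) * (t + c * X)
      + z * z * (x * x * x) * ((1# - z * x) * (t′ + poch (z * x) n * (Z * X)))
      + x * X * ((1# - x) * c′ + x * (c′ * (1# - z ^ suc (suc n) * x)))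
      ≈⟨ solve 9 (λ z x t t′ c cz c′ Z X →
           (one :- x) :* (t :+ c :* X)
             :+ z :* z :* (x :* x :* x) :* ((one :- z :* x) :* (t′ :+ cz :* (Z :* X)))
             :+ x :* X :* ((one :- x) :* c′ :+ x :* (c′ :* (one :- z :* (z :* Z) :* x))) :=
           (one :- x) :* t :+ z :* z :* (x :* x :* x) :* ((one :- z :* x) :* t′)
             :+ X :* ((one :- x) :* c :+ x :* c′)
             :+ z :* z :* (x :* x :* x) :* (Z :* X) :* ((one :- z :* x) :* cz :- c′))
           refl z x t t′ c (poch (z * x) n) c′ Z X ⟩
    (1# - x) * t + z * z * (x * x * x) * ((1# - z * x) * t′) + remainder n x
      + z * z * (x * x * x) * (Z * X) * ((1# - z * x) * poch (z * x) n - c′)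
      ≈⟨ +-cong (T-functional n x) (*-congˡ (x≈y⇒x-y≈0 (poch-shift x n))) ⟩
    1# - z * (x * x) + z * z * (x * x * x) * (Z * X) * 0#
      ≈⟨ trans (+-congˡ (zeroʳ _)) (+-identityʳ _) ⟩
    1# - z * (x * x) ∎
    where
    X = x ^ n
    Z = z ^ n
    c = poch x n
    c′ = poch x (suc n)
    t = T n x
    t′ = T n (z * x)

  -- Iteration around a root of unity

  pow-period : ∀ {m e} → z ^ m ≈ 1# → m ∣ℕ e → z ^ e ≈ 1#
  pow-period {m} z^m≈1 (divides-refl q) = begin
    z ^ (q ℕ.* m) ≡⟨ ≡.cong (z ^_) (ℕₚ.*-comm q m) ⟩
    z ^ (m ℕ.* q) ≈⟨ ^-assocʳ z m q ⟨
    (z ^ m) ^ q   ≈⟨ ^-congˡ q z^m≈1 ⟩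
    1# ^ q        ≈⟨ 1^ q ⟩
    1#            ∎
    where
    1^ : ∀ q → 1# ^ q ≈ 1#
    1^ zero = refl
    1^ (suc q) = trans (*-identityˡ _) (1^ q)

  poch-prefix : ∀ x n d → ∃ λ y → poch x (d ℕ.+ n) ≈ poch x n * y
  poch-prefix x n zero = 1# , sym (*-identityʳ _)
  poch-prefix x n (suc d) with poch-prefix x n d
  ... | y , eq = _ , trans (*-congʳ eq) (*-assoc _ _ _)

  -- The points reached from x = 1 + u by repeated multiplication by z. The infinitesimal u is
  -- needed because at x = 1 the factor 1 - x would erase T(x).
  node : Carrier → ℕ → Carrier
  node u k = z ^ k * (1# + u)

  node-periodic : ∀ u {m k} e → z ^ m ≈ 1# → m ∣ℕ e ℕ.+ k → z ^ e * node u k ≈ 1# + u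
  node-periodic u {m} {k} e z^m≈1 m∣e+k = begin
    z ^ e * (z ^ k * (1# + u)) ≈⟨ *-assoc _ _ _ ⟨
    z ^ e * z ^ k * (1# + u)   ≈⟨ *-congʳ (^-homo-* z e k) ⟨
    z ^ (e ℕ.+ k) * (1# + u)   ≈⟨ *-congʳ (pow-period z^m≈1 m∣e+k) ⟩
    1# * (1# + u)              ≈⟨ *-identityˡ _ ⟩
    1# + u                     ∎

  -- Among the first 2m factors of the product, those of index ≡ -k (mod m) equal -u, and there are two.
  poch-null : ∀ {u m} → u * u ≈ 0# → z ^ m ≈ 1# →
              ∀ {k n} → k ℕ.< m → m ℕ.+ m ℕ.≤ n → poch (node u k) n ≈ 0#
  poch-null {u} {m} u²≈0 z^m≈1 {k} {n} k<m 2m≤n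
    with i , ≡.refl ← ℕₚ.m≤n⇒∃[o]m+o≡n k<m
    with d , ≡.refl ← ℕₚ.m≤n⇒∃[o]m+o≡n 2m≤n
    = begin
    poch x (m ℕ.+ m ℕ.+ d)
      ≡⟨ ≡.cong (poch x) (ℕ-solve 3 (λ k i d → (ℕ-con 1 ⊕ k ⊕ i) ⊕ (ℕ-con 1 ⊕ k ⊕ i) ⊕ d
           ⊜ (k ⊕ d) ⊕ (ℕ-con 1 ⊕ (k ⊕ i ⊕ (ℕ-con 1 ⊕ i)))) ≡.refl k i d) ⟩
    poch x (k ℕ.+ d ℕ.+ suc j)
      ≈⟨ tail .proj₂ ⟩
    poch x j * (1# - z ^ suc j * x) * tail .proj₁
      ≈⟨ *-congʳ (*-cong (mid .proj₂) (+-congˡ (-‿cong (node-periodic u (suc j) z^m≈1 m∣1+j+k)))) ⟩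
    poch x i * (1# - z ^ suc i * x) * mid .proj₁ * (1# - (1# + u)) * tail .proj₁
      ≈⟨ *-congʳ (*-congʳ (*-congʳ (*-congˡ (+-congˡ (-‿cong (node-periodic u (suc i) z^m≈1 m∣1+i+k)))))) ⟩
    poch x i * (1# - (1# + u)) * mid .proj₁ * (1# - (1# + u)) * tail .proj₁
      ≈⟨ solve 4 (λ u a b c → a :* (one :- (one :+ u)) :* b :* (one :- (one :+ u)) :* c
           := u :* u :* (a :* b :* c)) refl u _ _ _ ⟩
    u * u * (poch x i * mid .proj₁ * tail .proj₁)
      ≈⟨ *-congʳ u²≈0 ⟩
    0# * (poch x i * mid .proj₁ * tail .proj₁)
      ≈⟨ zeroˡ _ ⟩
    0# ∎
    where
    x = node u k
    -- Since m = k + 1 + i, the index `suc i` is m - k and `suc j` is 2m - k, the first two indices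
    -- congruent to -k.
    j = k ℕ.+ i ℕ.+ suc i
    tail = poch-prefix x (suc j) (k ℕ.+ d)
    mid = poch-prefix x (suc i) (k ℕ.+ i)
    m∣1+i+k : m ∣ℕ suc i ℕ.+ k
    m∣1+i+k = divides 1 (ℕ-solve 2 (λ k i → (ℕ-con 1 ⊕ i) ⊕ k ⊜ (ℕ-con 1 ⊕ k ⊕ i) ⊕ ℕ-con 0) ≡.refl k i)
    m∣1+j+k : m ∣ℕ suc j ℕ.+ k
    m∣1+j+k = divides 2 (ℕ-solve 2 (λ k i →
      (ℕ-con 1 ⊕ (k ⊕ i ⊕ (ℕ-con 1 ⊕ i))) ⊕ k ⊜ (ℕ-con 1 ⊕ k ⊕ i) ⊕ ((ℕ-con 1 ⊕ k ⊕ i) ⊕ ℕ-con 0)) ≡.refl k i)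

  S : Carrier → ℕ → ℕ → Carrier
  S u n k = (1# - node u k) * T n (node u k)

  -- The functional equation solved for its first term; its remainder is zero by `poch-null`.
  S-step : ∀ {u m} → u * u ≈ 0# → z ^ m ≈ 1# → ∀ {k n} → k ℕ.< m → m ℕ.+ m ℕ.≤ n →
    S u n k ≈ 1# - z * (node u k * node u k)
                - z * z * (node u k * node u k * node u k) * S u n (suc k)
  S-step {u} u²≈0 z^m≈1 {k} {n} k<m 2m≤n = begin
    s ≈⟨ solve 3 (λ s a r → s := s :+ a :+ r :- a :- r) refl s a r ⟩
    s + a + r - a - r
      ≈⟨ +-cong (+-cong (T-functional n x) (-‿cong (*-congˡ next))) (-‿cong r≈0) ⟩
    1# - z * (x * x) - z * z * (x * x * x) * S u n (suc k) - 0#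
      ≈⟨ trans (+-congˡ -0#≈0#) (+-identityʳ _) ⟩
    1# - z * (x * x) - z * z * (x * x * x) * S u n (suc k) ∎
    where
    x = node u k
    s = S u n k
    a = z * z * (x * x * x) * ((1# - z * x) * T n (z * x))
    r = remainder n x
    zx≈ : z * x ≈ node u (suc k)
    zx≈ = sym (*-assoc _ _ _)
    next : (1# - z * x) * T n (z * x) ≈ S u n (suc k)
    next = *-cong (+-congˡ (-‿cong zx≈)) (T-cong n zx≈)
    r≈0 : r ≈ 0#
    r≈0 = begin
      x ^ n * ((1# - x) * poch x n + x * poch x (suc n))
        ≈⟨ *-congˡ (+-cong (*-congˡ (poch-null u²≈0 z^m≈1 k<m 2m≤n))
             (*-congˡ (poch-null u²≈0 z^m≈1 k<m (ℕₚ.m≤n⇒m≤1+n 2m≤n)))) ⟩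
      x ^ n * ((1# - x) * 0# + x * 0#)
        ≈⟨ *-congˡ (+-cong (zeroʳ _) (zeroʳ _)) ⟩
      x ^ n * (0# + 0#)
        ≈⟨ *-congˡ (+-identityʳ _) ⟩
      x ^ n * 0#
        ≈⟨ zeroʳ _ ⟩
      0# ∎

  sign : ℕ → Carrier
  sign zero = 1#
  sign (suc k) = - sign k

  cubes : Carrier → ℕ → Carrier
  cubes u zero = 1#
  cubes u (suc k) = cubes u k * ((1# + u) * (1# + u) * (1# + u))

  -- The product of the multipliers -z² x³ over the first k nodes; the exponents 3i + 2 of z add up
  -- to `pent₁ k`, and `cubes u k` is (1 + u)^(3k).
  lead : Carrier → ℕ → Carrier
  lead u k = sign k * z ^ pent₁ k * cubes u k

  P : Carrier → ℕ → Carrier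
  P u k = sum k (λ i → lead u i * (1# - z ^ suc (i ℕ.+ i) * ((1# + u) * (1# + u))))

  -- Iterates `S-step`; `P` gathers the inhomogeneous terms 1 - z x², each with its accumulated
  -- multiplier.
  unroll : ∀ {u m} → u * u ≈ 0# → z ^ m ≈ 1# → ∀ k {n} → k ℕ.≤ m → m ℕ.+ m ℕ.≤ n →
    S u n 0 ≈ P u k + lead u k * S u n k
  unroll {u} u²≈0 z^m≈1 zero {n} k≤m 2m≤n =
    sym (trans (+-identityˡ _) (trans (*-congʳ (trans (*-identityʳ _) (*-identityʳ _))) (*-identityˡ _)))
  unroll {u} u²≈0 z^m≈1 (suc k) {n} k<m 2m≤n = begin
    S u n 0
      ≈⟨ unroll u²≈0 z^m≈1 k (ℕₚ.<⇒≤ k<m) 2m≤n ⟩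
    P u k + σ * G * V * S u n k
      ≈⟨ +-congˡ (*-congˡ (S-step u²≈0 z^m≈1 k<m 2m≤n)) ⟩
    P u k + σ * G * V * (1# - z * (Z * w * (Z * w)) - z * z * (Z * w * (Z * w) * (Z * w)) * S u n (suc k))
      ≈⟨ solve 8 (λ z Z w p σ G V s →
           p :+ σ :* G :* V :* (one :- z :* (Z :* w :* (Z :* w)) :- z :* z :* (Z :* w :* (Z :* w) :* (Z :* w)) :* s)
           := p :+ σ :* G :* V :* (one :- z :* (Z :* Z) :* (w :* w))
             :+ (:- σ) :* (z :* (z :* (Z :* Z :* Z :* G))) :* (V :* (w :* w :* w)) :* s)
           refl z Z w (P u k) σ G V (S u n (suc k)) ⟩
    P u k + σ * G * V * (1# - z * (Z * Z) * (w * w)) + (- σ) * (z * (z * (Z * Z * Z * G))) * (V * (w * w * w)) * S u n (suc k)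
      ≈⟨ +-cong (+-congˡ (*-congˡ (+-congˡ (-‿cong (*-congʳ (*-congˡ (^-homo-* z k k)))))))
           (*-congʳ (*-congʳ (*-congˡ (*-congˡ (*-congˡ split))))) ⟨
    P u (suc k) + lead u (suc k) * S u n (suc k) ∎
    where
    w = 1# + u
    Z = z ^ k
    G = z ^ pent₁ k
    σ = sign k
    V = cubes u k
    split : z ^ (k ℕ.+ k ℕ.+ k ℕ.+ pent₁ k) ≈ Z * Z * Z * G
    split = trans (^-homo-* z (k ℕ.+ k ℕ.+ k) (pent₁ k)) (*-congʳ
      (trans (^-homo-* z (k ℕ.+ k) k) (*-congʳ (^-homo-* z k k))))

  sign-double : ∀ h → sign (h ℕ.+ h) ≈ 1#
  sign-double zero = refl
  sign-double (suc h) = begin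
    - sign (h ℕ.+ suc h) ≡⟨ ≡.cong (λ k → - sign k) (ℕₚ.+-suc h h) ⟩
    - - sign (h ℕ.+ h)   ≈⟨ -‿involutive _ ⟩
    sign (h ℕ.+ h)       ≈⟨ sign-double h ⟩
    1#                   ∎

  -- The Kontsevich-Zagier series Σ (z; z)_i, cut off after n terms.
  F : ℕ → Carrier
  F n = sum n (poch 1#)

  module _ {u : Carrier} (u²≈0 : u * u ≈ 0#) where

    private
      x = node u 0

      -- As u² = 0, a product with u depends only on the value of the other factor at u = 0, where x
      -- = 1. The next lemmas extend this to powers and products.
      ux≈u : u * x ≈ u
      ux≈u = trans (solve 1 (λ u → u :* (one :* (one :+ u)) := u :+ u :* u :* one) refl u)
                   (drop-null 1# u²≈0)

      u*x^≈u : ∀ n → u * x ^ n ≈ u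
      u*x^≈u zero = *-identityʳ u
      u*x^≈u (suc n) = trans (sym (*-assoc _ _ _)) (trans (*-congʳ ux≈u) (u*x^≈u n))

      u*poch : ∀ n → u * poch x n ≈ u * poch 1# n
      u*poch zero = refl
      u*poch (suc n) = begin
        u * (poch x n * (1# - y * x))
          ≈⟨ solve 4 (λ u x c y → u :* (c :* (one :- y :* x)) := u :* c :- y :* c :* (u :* x))
               refl u x (poch x n) y ⟩
        u * poch x n - y * poch x n * (u * x)
          ≈⟨ +-congˡ (-‿cong (*-congˡ ux≈u)) ⟩
        u * poch x n - y * poch x n * u
          ≈⟨ solve 3 (λ u c y → u :* c :- y :* c :* u := u :* c :* (one :- y :* one))
               refl u (poch x n) y ⟩
        u * poch x n * (1# - y * 1#)
          ≈⟨ *-congʳ (u*poch n) ⟩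
        u * poch 1# n * (1# - y * 1#)
          ≈⟨ *-assoc _ _ _ ⟩
        u * (poch 1# n * (1# - y * 1#)) ∎
        where y = z ^ suc n

      u*cubes : ∀ k → u * cubes u k ≈ u
      u*cubes zero = *-identityʳ u
      u*cubes (suc k) = begin
        u * (cubes u k * ((1# + u) * (1# + u) * (1# + u)))
          ≈⟨ solve 2 (λ u v → u :* (v :* ((one :+ u) :* (one :+ u) :* (one :+ u)))
               := u :* v :+ u :* u :* (v :* (con (+ 3) :+ con (+ 3) :* u :+ u :* u))) refl u (cubes u k) ⟩
        u * cubes u k + u * u * _
          ≈⟨ drop-null _ u²≈0 ⟩
        u * cubes u k
          ≈⟨ u*cubes k ⟩
        u ∎

    -- At x = 1 + u the factor 1 - x is -u, which reduces the series beside it to its value at x =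
    -- 1.
    S≈-uF : ∀ n → S u n 0 ≈ - (u * F n)
    S≈-uF n = begin
      (1# - 1# * (1# + u)) * T n x
        ≈⟨ solve 2 (λ u t → (one :- one :* (one :+ u)) :* t := :- (u :* t)) refl u (T n x) ⟩
      - (u * T n x)
        ≈⟨ -‿cong (*-distribˡ-sum u n _) ⟩
      - sum n (λ i → u * (poch x i * x ^ i))
        ≈⟨ -‿cong (sum-cong n term) ⟩
      - sum n (λ i → u * poch 1# i)
        ≈⟨ -‿cong (*-distribˡ-sum u n _) ⟨
      - (u * F n) ∎
      where
      term : ∀ i → u * (poch x i * x ^ i) ≈ u * poch 1# i
      term i = begin
        u * (poch x i * x ^ i) ≈⟨ solve 3 (λ u c y → u :* (c :* y) := u :* y :* c) refl u _ _ ⟩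
        u * x ^ i * poch x i   ≈⟨ *-congʳ (u*x^≈u i) ⟩
        u * poch x i           ≈⟨ u*poch i ⟩
        u * poch 1# i          ∎

    -- After m steps the node is 1 + u again, and for odd m the multiplier `lead u m` is -(1 +
    -- u)^(3m). So S = P - (1 + u)^(3m) S, and since S is a multiple of u, this says P = 2S.
    P≈-2uF : ∀ h → z ^ suc (h ℕ.+ h) ≈ 1# → ∀ {n} → suc (h ℕ.+ h) ℕ.+ suc (h ℕ.+ h) ℕ.≤ n →
      P u (suc (h ℕ.+ h)) ≈ - (u * F n + u * F n)
    P≈-2uF h z^m≈1 {n} 2m≤n = begin
      P u m
        ≈⟨ solve 3 (λ s p l → p := p :+ l :* s :- l :* s) refl (S u n 0) (P u m) (lead u m) ⟩
      P u m + lead u m * S u n 0 - lead u m * S u n 0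
        ≈⟨ +-cong (sym wrap) (-‿cong (*-cong (*-congʳ (*-cong (-‿cong (sign-double h))
             (pow-period z^m≈1 (m∣pent₁[m] h)))) (S≈-uF n))) ⟩
      S u n 0 - (- 1# * 1# * cubes u m) * (- (u * F n))
        ≈⟨ +-cong (S≈-uF n) (-‿cong (solve 3 (λ u f v → (:- one :* one :* v) :* (:- (u :* f)) := u :* v :* f)
             refl u (F n) (cubes u m))) ⟩
      - (u * F n) - (u * cubes u m * F n)
        ≈⟨ +-congˡ (-‿cong (*-congʳ (u*cubes m))) ⟩
      - (u * F n) - (u * F n)
        ≈⟨ -‿+-comm _ _ ⟩
      - (u * F n + u * F n) ∎
      where
      m = suc (h ℕ.+ h)
      wrap : S u n 0 ≈ P u m + lead u m * S u n 0
      wrap = trans (unroll u²≈0 z^m≈1 m ℕₚ.≤-refl 2m≤n) (+-congˡ (*-congˡ (*-cong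
        (+-congˡ (-‿cong node-m)) (T-cong n node-m))))
        where
        node-m : node u m ≈ node u 0
        node-m = *-congʳ z^m≈1

    -- The expansion (1 + u)^(3k) = 1 + 3k u, doubled so that the slope is 6k, and written with 1 +
    -- 6k to match the coefficients in `E`.
    cubes-linear : ∀ k → cubes u k + cubes u k ≈ 1# + 1# + (⟦ + (1 ℕ.+ 6 ℕ.* k) ⟧ - 1#) * u
    cubes-linear zero = begin
      1# + 1#
        ≈⟨ solve 1 (λ u → one :+ one := one :+ one :+ (con (+ 1) :- one) :* u) refl u ⟩
      1# + 1# + (⟦ + 1 ⟧ - 1#) * u ∎
    cubes-linear (suc k) = begin
      cubes u k * (w * w * w) + cubes u k * (w * w * w)
        ≈⟨ distribʳ _ _ _ ⟨
      (cubes u k + cubes u k) * (w * w * w)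
        ≈⟨ *-congʳ (cubes-linear k) ⟩
      (1# + 1# + (κ - 1#) * u) * (w * w * w)
        ≈⟨ solve 2 (λ u κ → (one :+ one :+ (κ :- one) :* u) :* ((one :+ u) :* (one :+ u) :* (one :+ u))
             := one :+ one :+ ((κ :+ con (+ 6)) :- one) :* u
               :+ u :* u :* ((κ :- one) :* (con (+ 3) :+ con (+ 3) :* u :+ u :* u) :+ con (+ 2) :* (con (+ 3) :+ u)))
             refl u κ ⟩
      1# + 1# + ((κ + ⟦ + 6 ⟧) - 1#) * u + u * u * _
        ≈⟨ drop-null _ u²≈0 ⟩
      1# + 1# + ((κ + ⟦ + 6 ⟧) - 1#) * u
        ≈⟨ +-congˡ (*-congʳ (+-congʳ (+-homo (+ (1 ℕ.+ 6 ℕ.* k)) (+ 6)))) ⟨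
      1# + 1# + (⟦ + (1 ℕ.+ 6 ℕ.* k ℕ.+ 6) ⟧ - 1#) * u
        ≡⟨ ≡.cong (λ e → 1# + 1# + (⟦ + e ⟧ - 1#) * u)
             (ℕ-solve 1 (λ k → ℕ-con 1 ⊕ ℕ-con 6 ⊗ k ⊕ ℕ-con 6 ⊜ ℕ-con 1 ⊕ ℕ-con 6 ⊗ (ℕ-con 1 ⊕ k)) ≡.refl k) ⟩
      1# + 1# + (⟦ + (1 ℕ.+ 6 ℕ.* suc k) ⟧ - 1#) * u ∎
      where
      w = 1# + u
      κ = ⟦ + (1 ℕ.+ 6 ℕ.* k) ⟧

  -- The negative of the right side of the strange identity. Each weight a and exponent e satisfy a²
  -- = 24 e + 1.
  E : ℕ → Carrier
  E k = sum k (λ i → sign i * (⟦ + (1 ℕ.+ 6 ℕ.* i) ⟧ * z ^ pent₁ i - ⟦ + (5 ℕ.+ 6 ℕ.* i) ⟧ * z ^ pent₅ i))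

  1+0≈1 : 1# + 0# ≈ 1#
  1+0≈1 = +-identityʳ 1#

  cubes-0 : ∀ k → cubes 0# k ≈ 1#
  cubes-0 zero = refl
  cubes-0 (suc k) = begin
    cubes 0# k * ((1# + 0#) * (1# + 0#) * (1# + 0#))
      ≈⟨ *-cong (cubes-0 k) (*-cong (*-cong 1+0≈1 1+0≈1) 1+0≈1) ⟩
    1# * (1# * 1# * 1#)
      ≈⟨ solve 0 (one :* (one :* one :* one) := one) refl ⟩
    1# ∎

  -- First-order expansion in u. The slopes that arise are 6k and 6k + 4; raising them to 6k + 1 and
  -- 6k + 5 accounts for the correction -u in front of `P 0# k`.
  P-linear : ∀ {u} → u * u ≈ 0# → ∀ k → P u k + P u k ≈ (1# + 1# - u) * P 0# k + u * E k
  P-linear {u} u²≈0 zero = sym (trans (+-congʳ (zeroʳ _)) (+-congˡ (zeroʳ u)))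
  P-linear {u} u²≈0 (suc k) = begin
    P u k + σ * G * V * (1# - y * (w * w)) + (P u k + σ * G * V * (1# - y * (w * w)))
      ≈⟨ solve 6 (λ u p σ G V y →
           p :+ σ :* G :* V :* (one :- y :* ((one :+ u) :* (one :+ u)))
             :+ (p :+ σ :* G :* V :* (one :- y :* ((one :+ u) :* (one :+ u)))) :=
           p :+ p :+ σ :* G :* (V :+ V) :* (one :- y :* ((one :+ u) :* (one :+ u))))
           refl u (P u k) σ G V y ⟩
    P u k + P u k + σ * G * (V + V) * (1# - y * (w * w))
      ≈⟨ +-cong (P-linear u²≈0 k) (*-congʳ (*-congˡ (cubes-linear u²≈0 k))) ⟩
    (1# + 1# - u) * P 0# k + u * E k + σ * G * (1# + 1# + (κ - 1#) * u) * (1# - y * (w * w))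
      ≈⟨ solve 7 (λ u p σ G y e κ →
           (one :+ one :- u) :* p :+ u :* e
             :+ σ :* G :* (one :+ one :+ (κ :- one) :* u) :* (one :- y :* ((one :+ u) :* (one :+ u))) :=
           (one :+ one :- u) :* (p :+ σ :* G :* one :* (one :- y :* (one :* one)))
             :+ u :* (e :+ σ :* (κ :* G :- (κ :+ con (+ 4)) :* (y :* G)))
             :+ u :* u :* (:- (σ :* G :* y) :* (con (+ 2) :+ (κ :- one) :* (con (+ 2) :+ u))))
           refl u (P 0# k) σ G y (E k) κ ⟩
    (1# + 1# - u) * (P 0# k + σ * G * 1# * (1# - y * (1# * 1#)))
      + u * (E k + σ * (κ * G - (κ + ⟦ + 4 ⟧) * (y * G))) + u * u * _
      ≈⟨ drop-null _ u²≈0 ⟩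
    (1# + 1# - u) * (P 0# k + σ * G * 1# * (1# - y * (1# * 1#)))
      + u * (E k + σ * (κ * G - (κ + ⟦ + 4 ⟧) * (y * G)))
      ≈⟨ +-cong
           (*-congˡ (+-congˡ (*-cong (*-congˡ (cubes-0 k)) (+-congˡ (-‿cong (*-congˡ (*-cong 1+0≈1 1+0≈1)))))))
           (*-congˡ (+-congˡ (*-congˡ (+-congˡ (-‿cong (*-cong κ+4 (^-homo-* z (suc (k ℕ.+ k)) (pent₁ k)))))))) ⟨
    (1# + 1# - u) * P 0# (suc k) + u * E (suc k) ∎
    where
    w = 1# + u
    σ = sign k
    G = z ^ pent₁ k
    V = cubes u k
    y = z ^ suc (k ℕ.+ k)
    κ = ⟦ + (1 ℕ.+ 6 ℕ.* k) ⟧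
    κ+4 : ⟦ + (5 ℕ.+ 6 ℕ.* k) ⟧ ≈ κ + ⟦ + 4 ⟧
    κ+4 = trans (reflexive (≡.cong (λ e → ⟦ + e ⟧) (ℕₚ.+-comm 4 (1 ℕ.+ 6 ℕ.* k))))
                (+-homo (+ (1 ℕ.+ 6 ℕ.* k)) (+ 4))

  -- Compares the value of 2P obtained from periodicity with its first-order expansion. The constant
  -- part `P 0# m` vanishes, because `P≈-2uF` holds for u = 0 too. The factor u remains, as it need
  -- not be cancellable in the ring.
  strange : ∀ {u} → u * u ≈ 0# → ∀ h → z ^ suc (h ℕ.+ h) ≈ 1# →
            ∀ {n} → suc (h ℕ.+ h) ℕ.+ suc (h ℕ.+ h) ℕ.≤ n →
            u * (⟦ + 4 ⟧ * F n) ≈ - (u * E (suc (h ℕ.+ h)))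
  strange {u} u²≈0 h z^m≈1 {n} 2m≤n = begin
    u * (⟦ + 4 ⟧ * F n)
      ≈⟨ solve 2 (λ u f → u :* (con (+ 4) :* f) := :- (:- (u :* f :+ u :* f) :+ :- (u :* f :+ u :* f)))
           refl u (F n) ⟩
    - (- (u * F n + u * F n) + - (u * F n + u * F n))
      ≈⟨ -‿cong (+-cong (P≈-2uF u²≈0 h z^m≈1 2m≤n) (P≈-2uF u²≈0 h z^m≈1 2m≤n)) ⟨
    - (P u m + P u m)
      ≈⟨ -‿cong (P-linear u²≈0 m) ⟩
    - ((1# + 1# - u) * P 0# m + u * E m)
      ≈⟨ -‿cong (+-congʳ (trans (*-congˡ P0≈0) (zeroʳ _))) ⟩
    - (0# + u * E m)
      ≈⟨ -‿cong (+-identityˡ _) ⟩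
    - (u * E m) ∎
    where
    m = suc (h ℕ.+ h)
    P0≈0 : P 0# m ≈ 0#
    P0≈0 = begin
      P 0# m                     ≈⟨ P≈-2uF (zeroˡ 0#) h z^m≈1 2m≤n ⟩
      - (0# * F n + 0# * F n)    ≈⟨ -‿cong (+-cong (zeroˡ _) (zeroˡ _)) ⟩
      - (0# + 0#)                ≈⟨ -‿cong (+-identityˡ 0#) ⟩
      - 0#                       ≈⟨ -0#≈0# ⟩
      0#                         ∎

-- The polynomial ring modulo d and q^N

open ≡ using (cong; cong₂; refl; sym; trans; subst; module ≡-Reasoning)

infix 4 _≗_

-- Lists that differ by trailing zeros represent the same polynomial, so coefficients are compared.
_≗_ : Poly → Poly → Set
f ≗ h = ∀ i → coeff i f ≡ coeff i h

coeff-addP : ∀ f h i → coeff i (addP f h) ≡ coeff i f ℤ.+ coeff i h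
coeff-addP [] h i = sym (ℤₚ.+-identityˡ _)
coeff-addP (x ∷ f) [] i = sym (ℤₚ.+-identityʳ _)
coeff-addP (x ∷ f) (y ∷ h) zero = refl
coeff-addP (x ∷ f) (y ∷ h) (suc i) = coeff-addP f h i

coeff-negP : ∀ f i → coeff i (negP f) ≡ ℤ.- coeff i f
coeff-negP [] i = refl
coeff-negP (x ∷ f) zero = refl
coeff-negP (x ∷ f) (suc i) = coeff-negP f i

coeff-map-* : ∀ c f i → coeff i (map (c ℤ.*_) f) ≡ c ℤ.* coeff i f
coeff-map-* c [] i = sym (ℤₚ.*-zeroʳ c)
coeff-map-* c (x ∷ f) zero = refl
coeff-map-* c (x ∷ f) (suc i) = coeff-map-* c f i

shift-cong : ∀ {f h} → f ≗ h → + 0 ∷ f ≗ + 0 ∷ h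
shift-cong eq zero = refl
shift-cong eq (suc i) = eq i

coeff-shift-addP : ∀ f h i → coeff i (+ 0 ∷ addP f h) ≡ coeff i (+ 0 ∷ f) ℤ.+ coeff i (+ 0 ∷ h)
coeff-shift-addP f h zero = refl
coeff-shift-addP f h (suc i) = coeff-addP f h i

coeff-mulP-∷ : ∀ x f h i → coeff i (mulP (x ∷ f) h) ≡ x ℤ.* coeff i h ℤ.+ coeff i (+ 0 ∷ mulP f h)
coeff-mulP-∷ x f h i = trans (coeff-addP (map (x ℤ.*_) h) _ i) (cong (ℤ._+ _) (coeff-map-* x h i))

mulP-congʳ : ∀ f {h k} → h ≗ k → mulP f h ≗ mulP f k
mulP-congʳ [] eq i = refl
mulP-congʳ (x ∷ f) {h} {k} eq i = begin
  coeff i (mulP (x ∷ f) h)                           ≡⟨ coeff-mulP-∷ x f h i ⟩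
  x ℤ.* coeff i h ℤ.+ coeff i (+ 0 ∷ mulP f h)
    ≡⟨ cong₂ (λ a b → x ℤ.* a ℤ.+ b) (eq i) (shift-cong (mulP-congʳ f eq) i) ⟩
  x ℤ.* coeff i k ℤ.+ coeff i (+ 0 ∷ mulP f k)       ≡⟨ coeff-mulP-∷ x f k i ⟨
  coeff i (mulP (x ∷ f) k)                           ∎
  where open ≡-Reasoning

mulP-zeroʳ : ∀ f → mulP f [] ≗ []
mulP-zeroʳ [] i = refl
mulP-zeroʳ (x ∷ f) zero = refl
mulP-zeroʳ (x ∷ f) (suc i) = mulP-zeroʳ f i

-- `mulP` recurses on its left factor; this mirror recursion on the right factor is what
-- commutativity rests on.
mulP-∷ʳ : ∀ f x h → mulP f (x ∷ h) ≗ addP (map (x ℤ.*_) f) (+ 0 ∷ mulP f h)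
mulP-∷ʳ [] x h zero = refl
mulP-∷ʳ [] x h (suc i) = refl
mulP-∷ʳ (y ∷ f) x h zero = cong (ℤ._+ + 0) (ℤₚ.*-comm y x)
mulP-∷ʳ (y ∷ f) x h (suc i) = begin
  coeff i (addP (map (y ℤ.*_) h) (mulP f (x ∷ h)))
    ≡⟨ coeff-addP (map (y ℤ.*_) h) _ i ⟩
  coeff i (map (y ℤ.*_) h) ℤ.+ coeff i (mulP f (x ∷ h))
    ≡⟨ cong₂ ℤ._+_ (coeff-map-* y h i) (mulP-∷ʳ f x h i) ⟩
  y ℤ.* coeff i h ℤ.+ coeff i (addP (map (x ℤ.*_) f) (+ 0 ∷ mulP f h))
    ≡⟨ cong (λ a → y ℤ.* coeff i h ℤ.+ a)
         (trans (coeff-addP (map (x ℤ.*_) f) _ i) (cong (ℤ._+ _) (coeff-map-* x f i))) ⟩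
  y ℤ.* coeff i h ℤ.+ (x ℤ.* coeff i f ℤ.+ coeff i (+ 0 ∷ mulP f h))
    ≡⟨ rearrange (y ℤ.* coeff i h) (x ℤ.* coeff i f) _ ⟩
  x ℤ.* coeff i f ℤ.+ (y ℤ.* coeff i h ℤ.+ coeff i (+ 0 ∷ mulP f h))
    ≡⟨ cong₂ ℤ._+_ (coeff-map-* x f i) (coeff-mulP-∷ y f h i) ⟨
  coeff i (map (x ℤ.*_) f) ℤ.+ coeff i (mulP (y ∷ f) h)
    ≡⟨ coeff-addP (map (x ℤ.*_) f) _ i ⟨
  coeff i (addP (map (x ℤ.*_) f) (mulP (y ∷ f) h)) ∎
  where
  open ≡-Reasoning
  rearrange : ∀ a b c → a ℤ.+ (b ℤ.+ c) ≡ b ℤ.+ (a ℤ.+ c)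
  rearrange = solve-∀

mulP-comm : ∀ f h → mulP f h ≗ mulP h f
mulP-comm [] h i = sym (mulP-zeroʳ h i)
mulP-comm (x ∷ f) h i = begin
  coeff i (mulP (x ∷ f) h)                             ≡⟨ coeff-mulP-∷ x f h i ⟩
  x ℤ.* coeff i h ℤ.+ coeff i (+ 0 ∷ mulP f h)
    ≡⟨ cong₂ ℤ._+_ (sym (coeff-map-* x h i)) (shift-cong (mulP-comm f h) i) ⟩
  coeff i (map (x ℤ.*_) h) ℤ.+ coeff i (+ 0 ∷ mulP h f) ≡⟨ coeff-addP (map (x ℤ.*_) h) _ i ⟨
  coeff i (addP (map (x ℤ.*_) h) (+ 0 ∷ mulP h f))      ≡⟨ mulP-∷ʳ h x f i ⟨
  coeff i (mulP h (x ∷ f))                              ∎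
  where open ≡-Reasoning

mulP-distribʳ : ∀ h f k → mulP (addP f k) h ≗ addP (mulP f h) (mulP k h)
mulP-distribʳ h [] k i = refl
mulP-distribʳ h (x ∷ f) [] i = sym (trans (coeff-addP (mulP (x ∷ f) h) [] i) (ℤₚ.+-identityʳ _))
mulP-distribʳ h (x ∷ f) (y ∷ k) i = begin
  coeff i (mulP (x ℤ.+ y ∷ addP f k) h)
    ≡⟨ coeff-mulP-∷ (x ℤ.+ y) (addP f k) h i ⟩
  (x ℤ.+ y) ℤ.* coeff i h ℤ.+ coeff i (+ 0 ∷ mulP (addP f k) h)
    ≡⟨ cong (λ a → (x ℤ.+ y) ℤ.* coeff i h ℤ.+ a)
         (trans (shift-cong (mulP-distribʳ h f k) i) (coeff-shift-addP (mulP f h) (mulP k h) i)) ⟩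
  (x ℤ.+ y) ℤ.* coeff i h ℤ.+ (coeff i (+ 0 ∷ mulP f h) ℤ.+ coeff i (+ 0 ∷ mulP k h))
    ≡⟨ rearrange x y _ _ _ ⟩
  x ℤ.* coeff i h ℤ.+ coeff i (+ 0 ∷ mulP f h) ℤ.+ (y ℤ.* coeff i h ℤ.+ coeff i (+ 0 ∷ mulP k h))
    ≡⟨ cong₂ ℤ._+_ (coeff-mulP-∷ x f h i) (coeff-mulP-∷ y k h i) ⟨
  coeff i (mulP (x ∷ f) h) ℤ.+ coeff i (mulP (y ∷ k) h)
    ≡⟨ coeff-addP (mulP (x ∷ f) h) (mulP (y ∷ k) h) i ⟨
  coeff i (addP (mulP (x ∷ f) h) (mulP (y ∷ k) h)) ∎
  where
  open ≡-Reasoning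
  rearrange : ∀ x y c a b → (x ℤ.+ y) ℤ.* c ℤ.+ (a ℤ.+ b) ≡ x ℤ.* c ℤ.+ a ℤ.+ (y ℤ.* c ℤ.+ b)
  rearrange = solve-∀

mulP-map-* : ∀ c f h i → coeff i (mulP (map (c ℤ.*_) f) h) ≡ c ℤ.* coeff i (mulP f h)
mulP-map-* c [] h i = sym (ℤₚ.*-zeroʳ c)
mulP-map-* c (x ∷ f) h i = begin
  coeff i (mulP (c ℤ.* x ∷ map (c ℤ.*_) f) h)
    ≡⟨ coeff-mulP-∷ (c ℤ.* x) (map (c ℤ.*_) f) h i ⟩
  c ℤ.* x ℤ.* coeff i h ℤ.+ coeff i (+ 0 ∷ mulP (map (c ℤ.*_) f) h)
    ≡⟨ cong (λ a → c ℤ.* x ℤ.* coeff i h ℤ.+ a) (shifted i) ⟩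
  c ℤ.* x ℤ.* coeff i h ℤ.+ c ℤ.* coeff i (+ 0 ∷ mulP f h)
    ≡⟨ rearrange c x _ _ ⟩
  c ℤ.* (x ℤ.* coeff i h ℤ.+ coeff i (+ 0 ∷ mulP f h))
    ≡⟨ cong (c ℤ.*_) (coeff-mulP-∷ x f h i) ⟨
  c ℤ.* coeff i (mulP (x ∷ f) h) ∎
  where
  open ≡-Reasoning
  rearrange : ∀ c x a b → c ℤ.* x ℤ.* a ℤ.+ c ℤ.* b ≡ c ℤ.* (x ℤ.* a ℤ.+ b)
  rearrange = solve-∀
  shifted : ∀ i → coeff i (+ 0 ∷ mulP (map (c ℤ.*_) f) h) ≡ c ℤ.* coeff i (+ 0 ∷ mulP f h)
  shifted zero = sym (ℤₚ.*-zeroʳ c)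
  shifted (suc i) = mulP-map-* c f h i

coeff-shift-mulP : ∀ f h i → coeff i (mulP (+ 0 ∷ f) h) ≡ coeff i (+ 0 ∷ mulP f h)
coeff-shift-mulP f h i = trans (coeff-mulP-∷ (+ 0) f h i)
  (trans (cong (λ a → a ℤ.+ coeff i (+ 0 ∷ mulP f h)) (ℤₚ.*-zeroˡ (coeff i h))) (ℤₚ.+-identityˡ _))

mulP-assoc : ∀ f h k → mulP (mulP f h) k ≗ mulP f (mulP h k)
mulP-assoc [] h k i = refl
mulP-assoc (x ∷ f) h k i = begin
  coeff i (mulP (addP (map (x ℤ.*_) h) (+ 0 ∷ mulP f h)) k)
    ≡⟨ mulP-distribʳ k (map (x ℤ.*_) h) (+ 0 ∷ mulP f h) i ⟩
  coeff i (addP (mulP (map (x ℤ.*_) h) k) (mulP (+ 0 ∷ mulP f h) k))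
    ≡⟨ coeff-addP (mulP (map (x ℤ.*_) h) k) _ i ⟩
  coeff i (mulP (map (x ℤ.*_) h) k) ℤ.+ coeff i (mulP (+ 0 ∷ mulP f h) k)
    ≡⟨ cong₂ ℤ._+_ (mulP-map-* x h k i)
         (trans (coeff-shift-mulP (mulP f h) k i) (shift-cong (mulP-assoc f h k) i)) ⟩
  x ℤ.* coeff i (mulP h k) ℤ.+ coeff i (+ 0 ∷ mulP f (mulP h k))
    ≡⟨ coeff-mulP-∷ x f (mulP h k) i ⟨
  coeff i (mulP (x ∷ f) (mulP h k)) ∎
  where open ≡-Reasoning

coeff-const-mulP : ∀ c f i → coeff i (mulP (c ∷ []) f) ≡ c ℤ.* coeff i f
coeff-const-mulP c f zero = trans (coeff-mulP-∷ c [] f zero) (ℤₚ.+-identityʳ _)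
coeff-const-mulP c f (suc i) = trans (coeff-mulP-∷ c [] f (suc i)) (ℤₚ.+-identityʳ _)

mulP-identityˡ : ∀ f → mulP oneP f ≗ f
mulP-identityˡ f i = trans (coeff-const-mulP (+ 1) f i) (ℤₚ.*-identityˡ _)

addP-comm : ∀ f h → addP f h ≗ addP h f
addP-comm f h i = trans (coeff-addP f h i) (trans (ℤₚ.+-comm (coeff i f) _) (sym (coeff-addP h f i)))

addP-assoc : ∀ f h k → addP (addP f h) k ≗ addP f (addP h k)
addP-assoc f h k i = begin
  coeff i (addP (addP f h) k)                   ≡⟨ coeff-addP (addP f h) k i ⟩
  coeff i (addP f h) ℤ.+ coeff i k              ≡⟨ cong (ℤ._+ coeff i k) (coeff-addP f h i) ⟩
  coeff i f ℤ.+ coeff i h ℤ.+ coeff i k         ≡⟨ ℤₚ.+-assoc (coeff i f) (coeff i h) (coeff i k) ⟩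
  coeff i f ℤ.+ (coeff i h ℤ.+ coeff i k)       ≡⟨ cong (λ a → coeff i f ℤ.+ a) (coeff-addP h k i) ⟨
  coeff i f ℤ.+ coeff i (addP h k)              ≡⟨ coeff-addP f (addP h k) i ⟨
  coeff i (addP f (addP h k))                   ∎
  where open ≡-Reasoning

addP-inverseʳ : ∀ f → addP f (negP f) ≗ []
addP-inverseʳ f i = trans (coeff-addP f (negP f) i)
  (trans (cong (λ a → coeff i f ℤ.+ a) (coeff-negP f i)) (ℤₚ.+-inverseʳ (coeff i f)))

mulP-distribˡ : ∀ h f k → mulP h (addP f k) ≗ addP (mulP h f) (mulP h k)
mulP-distribˡ h f k i = begin
  coeff i (mulP h (addP f k))                   ≡⟨ mulP-comm h (addP f k) i ⟩
  coeff i (mulP (addP f k) h)                   ≡⟨ mulP-distribʳ h f k i ⟩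
  coeff i (addP (mulP f h) (mulP k h))          ≡⟨ coeff-addP (mulP f h) _ i ⟩
  coeff i (mulP f h) ℤ.+ coeff i (mulP k h)     ≡⟨ cong₂ ℤ._+_ (mulP-comm f h i) (mulP-comm k h i) ⟩
  coeff i (mulP h f) ℤ.+ coeff i (mulP h k)     ≡⟨ coeff-addP (mulP h f) _ i ⟨
  coeff i (addP (mulP h f) (mulP h k))          ∎
  where open ≡-Reasoning

monomial : ℕ → Poly
monomial zero = oneP
monomial (suc k) = + 0 ∷ monomial k

coeff-monomial-< : ∀ {i k} → i ℕ.< k → coeff i (monomial k) ≡ + 0
coeff-monomial-< {zero} (s≤s _) = refl
coeff-monomial-< {suc i} (s≤s i<k) = coeff-monomial-< i<k

coeff-monomial-mulP : ∀ k f i → coeff (k ℕ.+ i) (mulP (monomial k) f) ≡ coeff i f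
coeff-monomial-mulP zero f i = mulP-identityˡ f i
coeff-monomial-mulP (suc k) f i =
  trans (coeff-shift-mulP (monomial k) f (suc k ℕ.+ i)) (coeff-monomial-mulP k f i)

OrderAtLeast : ℕ → Poly → Set
OrderAtLeast a f = ∀ i → i ℕ.< a → coeff i f ≡ + 0

mulP-order : ∀ a b f h → OrderAtLeast a f → OrderAtLeast b h → OrderAtLeast (a ℕ.+ b) (mulP f h)
mulP-order a b [] h of oh i i<a+b = refl
mulP-order zero b (x ∷ f) h of oh i i<b = begin
  coeff i (mulP (x ∷ f) h)                       ≡⟨ coeff-mulP-∷ x f h i ⟩
  x ℤ.* coeff i h ℤ.+ coeff i (+ 0 ∷ mulP f h)   ≡⟨ cong₂ (λ s t → x ℤ.* s ℤ.+ t) (oh i i<b) (tail i i<b) ⟩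
  x ℤ.* + 0 ℤ.+ + 0                              ≡⟨ cong (ℤ._+ + 0) (ℤₚ.*-zeroʳ x) ⟩
  + 0                                            ∎
  where
  open ≡-Reasoning
  tail : ∀ i → i ℕ.< b → coeff i (+ 0 ∷ mulP f h) ≡ + 0
  tail zero _ = refl
  tail (suc i) 1+i<b = mulP-order zero b f h (λ _ ()) oh i (ℕₚ.<-trans (ℕₚ.n<1+n i) 1+i<b)
-- The constant coefficient of the left factor is zero, so that factor is a shift by q and the
-- required order drops by one.
mulP-order (suc a) b (x ∷ f) h of oh i i<a+b rewrite of zero (s≤s z≤n) =
  trans (coeff-shift-mulP f h i) (tail i i<a+b)
  where
  tail : ∀ i → i ℕ.< suc (a ℕ.+ b) → coeff i (+ 0 ∷ mulP f h) ≡ + 0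
  tail zero _ = refl
  tail (suc i) (s≤s i<a+b) = mulP-order a b f h (λ k k<a → of (suc k) (s≤s k<a)) oh i i<a+b

module Truncated (d : ℤ) (N : ℕ) where

  infix 4 _≈_

  -- A record, so that f and h can be recovered from the type of a proof.
  record _≈_ (f h : Poly) : Set where
    constructor mk≈
    field coeff-≈ : ∀ i → i ℕ.< N → d ∣ₛ coeff i f ℤ.- coeff i h
  open _≈_ public

  ≗⇒≈ : ∀ {f h} → f ≗ h → f ≈ h
  ≗⇒≈ eq = mk≈ λ i _ → subst (d ∣ₛ_) (sym (ℤₚ.i≡j⇒i-j≡0 (eq i))) (dividesₛ (+ 0) refl)

  ≈-sym : ∀ {f h} → f ≈ h → h ≈ f
  ≈-sym {f} {h} (mk≈ eq) = mk≈ λ i i<N →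
    subst (d ∣ₛ_) (flip (coeff i f) (coeff i h)) (∣m⇒∣-m (eq i i<N))
    where
    flip : ∀ a b → ℤ.- (a ℤ.- b) ≡ b ℤ.- a
    flip = solve-∀

  ≈-trans : ∀ {f h k} → f ≈ h → h ≈ k → f ≈ k
  ≈-trans {f} {h} {k} (mk≈ eq₁) (mk≈ eq₂) = mk≈ λ i i<N →
    subst (d ∣ₛ_) (telescope (coeff i f) (coeff i h) (coeff i k)) (∣m∣n⇒∣m+n (eq₁ i i<N) (eq₂ i i<N))
    where
    telescope : ∀ a b c → (a ℤ.- b) ℤ.+ (b ℤ.- c) ≡ a ℤ.- c
    telescope = solve-∀

  addP-cong : ∀ {f f′ h h′} → f ≈ f′ → h ≈ h′ → addP f h ≈ addP f′ h′
  addP-cong {f} {f′} {h} {h′} (mk≈ eq₁) (mk≈ eq₂) = mk≈ λ i i<N → subst (d ∣ₛ_)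
    (trans (regroup (coeff i f) (coeff i f′) (coeff i h) (coeff i h′))
           (sym (cong₂ ℤ._-_ (coeff-addP f h i) (coeff-addP f′ h′ i))))
    (∣m∣n⇒∣m+n (eq₁ i i<N) (eq₂ i i<N))
    where
    regroup : ∀ a b c e → (a ℤ.- b) ℤ.+ (c ℤ.- e) ≡ (a ℤ.+ c) ℤ.- (b ℤ.+ e)
    regroup = solve-∀

  negP-cong : ∀ {f h} → f ≈ h → negP f ≈ negP h
  negP-cong {f} {h} (mk≈ eq) = mk≈ λ i i<N → subst (d ∣ₛ_)
    (trans (ℤₚ.neg-distrib-+ (coeff i f) (ℤ.- coeff i h))
           (sym (cong₂ ℤ._-_ (coeff-negP f i) (coeff-negP h i))))
    (∣m⇒∣-m (eq i i<N))

  mulP-congˡ : ∀ k {f h} → f ≈ h → mulP k f ≈ mulP k h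
  mulP-congˡ k {f} {h} (mk≈ eq) = mk≈ (go k)
    where
    regroup : ∀ x a b c e → x ℤ.* (a ℤ.- b) ℤ.+ (c ℤ.- e) ≡ (x ℤ.* a ℤ.+ c) ℤ.- (x ℤ.* b ℤ.+ e)
    regroup = solve-∀
    go : ∀ k i → i ℕ.< N → d ∣ₛ coeff i (mulP k f) ℤ.- coeff i (mulP k h)
    go [] i i<N = dividesₛ (+ 0) refl
    go (x ∷ k) i i<N = subst (d ∣ₛ_)
      (trans (regroup x (coeff i f) (coeff i h) _ _)
             (sym (cong₂ ℤ._-_ (coeff-mulP-∷ x k f i) (coeff-mulP-∷ x k h i))))
      (∣m∣n⇒∣m+n (∣n⇒∣m*n x (eq i i<N)) (tail i i<N))
      where
      tail : ∀ i → i ℕ.< N → d ∣ₛ coeff i (+ 0 ∷ mulP k f) ℤ.- coeff i (+ 0 ∷ mulP k h)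
      tail zero _ = dividesₛ (+ 0) refl
      tail (suc i) 1+i<N = go k i (ℕₚ.<-trans (ℕₚ.n<1+n i) 1+i<N)

  mulP-cong : ∀ {f f′ h h′} → f ≈ f′ → h ≈ h′ → mulP f h ≈ mulP f′ h′
  mulP-cong {f} {f′} {h} {h′} f≈f′ h≈h′ =
    ≈-trans (mulP-congˡ f h≈h′) (≈-trans (≗⇒≈ (mulP-comm f h′))
      (≈-trans (mulP-congˡ h′ f≈f′) (≗⇒≈ (mulP-comm h′ f′))))

  commutativeRing : CommutativeRing 0ℓ 0ℓ
  commutativeRing = record
    { Carrier = Poly
    ; _≈_ = _≈_
    ; _+_ = addP
    ; _*_ = mulP
    ; -_ = negP
    ; 0# = []
    ; 1# = oneP
    ; isCommutativeRing = record
      { isRing = record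
        { +-isAbelianGroup = record
          { isGroup = record
            { isMonoid = record
              { isSemigroup = record
                { isMagma = record
                  { isEquivalence = record { refl = ≗⇒≈ (λ _ → refl) ; sym = ≈-sym ; trans = ≈-trans }
                  ; ∙-cong = addP-cong
                  }
                ; assoc = λ f h k → ≗⇒≈ (addP-assoc f h k)
                }
              ; identity = (λ _ → ≗⇒≈ (λ _ → refl)) , λ f → ≗⇒≈ (λ i → trans (coeff-addP f [] i) (ℤₚ.+-identityʳ _))
              }
            ; inverse = (λ f → ≗⇒≈ (λ i → trans (addP-comm (negP f) f i) (addP-inverseʳ f i)))
                      , λ f → ≗⇒≈ (addP-inverseʳ f)
            ; ⁻¹-cong = negP-cong
            }
          ; comm = λ f h → ≗⇒≈ (addP-comm f h)
          }
        ; *-cong = mulP-cong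
        ; *-assoc = λ f h k → ≗⇒≈ (mulP-assoc f h k)
        ; *-identity = (λ f → ≗⇒≈ (mulP-identityˡ f))
                     , λ f → ≗⇒≈ (λ i → trans (mulP-comm f oneP i) (mulP-identityˡ f i))
        ; distrib = (λ h f k → ≗⇒≈ (mulP-distribˡ h f k)) , λ h f k → ≗⇒≈ (mulP-distribʳ h f k)
        }
      ; *-comm = λ f h → ≗⇒≈ (mulP-comm f h)
      }
    }

  constants : CommutativeRing.rawRing ℤₚ.+-*-commutativeRing
                -Raw-AlmostCommutative⟶ fromCommutativeRing commutativeRing
  constants = record
    { ⟦_⟧ = λ c → c ∷ []
    ; +-homo = λ _ _ → ≗⇒≈ (λ _ → refl)
    ; *-homo = λ a b → ≗⇒≈ λ where
        zero → sym (ℤₚ.+-identityʳ (a ℤ.* b))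
        (suc i) → refl
    ; -‿homo = λ _ → ≗⇒≈ (λ _ → refl)
    ; 0-homo = ≗⇒≈ λ where
        zero → refl
        (suc i) → refl
    ; 1-homo = ≗⇒≈ (λ _ → refl)
    }

-- Coefficients of powers of 1 - q

open import Algebra.Properties.CommutativeSemigroup ℕₚ.*-commutativeSemigroup using (x∙yz≈y∙xz)
open import Data.Nat using (_+_; _*_; _∸_; _^_; _≤_; _<_; NonZero; ⌊_/2⌋)
open import Data.Nat.DivMod using (_%_; _/_; m≡m%n+[m/n]*n; m%n<n)
open import Data.Nat.Primality
  using (Prime; euclidsLemma; prime⇒irreducible; prime⇒nonTrivial; prime⇒nonZero)
open import Data.Sum using (_⊎_; inj₁; inj₂; reduce)

-- binom e i is (-1)^i times the binomial coefficient e choose i.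
binom : ℕ → ℕ → ℤ
binom e i = coeff i (powP oneMinusQ e)

binom-zero : ∀ e → binom e 0 ≡ + 1
binom-zero zero = refl
binom-zero (suc e) = trans (coeff-mulP-∷ (+ 1) (-[1+ 0 ] ∷ []) (powP oneMinusQ e) 0)
  (trans (ℤₚ.+-identityʳ _) (trans (ℤₚ.*-identityˡ _) (binom-zero e)))

binom-suc : ∀ e i → binom (suc e) (suc i) ≡ binom e (suc i) ℤ.- binom e i
binom-suc e i = trans (coeff-mulP-∷ (+ 1) (-[1+ 0 ] ∷ []) (powP oneMinusQ e) (suc i))
  (cong₂ ℤ._+_ (ℤₚ.*-identityˡ (binom e (suc i)))
    (trans (coeff-const-mulP -[1+ 0 ] (powP oneMinusQ e) i) (ℤₚ.-1*i≡-i (binom e i))))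

-- The coefficients of (1 - q)^e, from the differential equation (1 - q) f′ = - e f.
binom-ratio : ∀ e i → + suc i ℤ.* binom e (suc i) ≡ (+ i ℤ.- + e) ℤ.* binom e i
binom-ratio zero zero = refl
binom-ratio zero (suc i) = trans (ℤₚ.*-zeroʳ (+ suc (suc i))) (sym (ℤₚ.*-zeroʳ (+ suc i ℤ.- + 0)))
binom-ratio (suc e) zero = begin
  + 1 ℤ.* binom (suc e) 1                ≡⟨ cong (+ 1 ℤ.*_) (binom-suc e 0) ⟩
  + 1 ℤ.* (binom e 1 ℤ.- binom e 0)      ≡⟨ ℤ-distrib (binom e 1) (binom e 0) ⟩
  + 1 ℤ.* binom e 1 ℤ.- binom e 0        ≡⟨ cong (ℤ._- binom e 0) (binom-ratio e 0) ⟩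
  (+ 0 ℤ.- + e) ℤ.* binom e 0 ℤ.- binom e 0  ≡⟨ ℤ-collect (+ e) (binom e 0) ⟩
  (+ 0 ℤ.- (+ 1 ℤ.+ + e)) ℤ.* binom e 0  ≡⟨ cong ((+ 0 ℤ.- + suc e) ℤ.*_) (trans (binom-zero e) (sym (binom-zero (suc e)))) ⟩
  (+ 0 ℤ.- + suc e) ℤ.* binom (suc e) 0  ∎
  where
  open ≡-Reasoning
  ℤ-distrib : ∀ a b → + 1 ℤ.* (a ℤ.- b) ≡ + 1 ℤ.* a ℤ.- b
  ℤ-distrib = solve-∀
  ℤ-collect : ∀ e b → (+ 0 ℤ.- e) ℤ.* b ℤ.- b ≡ (+ 0 ℤ.- (+ 1 ℤ.+ e)) ℤ.* b
  ℤ-collect = solve-∀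
binom-ratio (suc e) (suc i) = begin
  + suc (suc i) ℤ.* binom (suc e) (suc (suc i))
    ≡⟨ cong (+ suc (suc i) ℤ.*_) (binom-suc e (suc i)) ⟩
  + suc (suc i) ℤ.* (c ℤ.- b)
    ≡⟨ expand (+ suc (suc i)) c b ⟩
  + suc (suc i) ℤ.* c ℤ.- + suc (suc i) ℤ.* b
    ≡⟨ cong (ℤ._- + suc (suc i) ℤ.* b) (binom-ratio e (suc i)) ⟩
  (+ suc i ℤ.- + e) ℤ.* b ℤ.- (+ 1 ℤ.+ + suc i) ℤ.* b
    -- The second summand of the result is the difference of the two sides of the identity for e and
    -- i, hence zero.
    ≡⟨ collect (+ i) (+ e) a b ⟩
  (+ suc i ℤ.- + suc e) ℤ.* (b ℤ.- a) ℤ.+ ((+ i ℤ.- + e) ℤ.* a ℤ.- + suc i ℤ.* b)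
    ≡⟨ cong (λ x → (+ suc i ℤ.- + suc e) ℤ.* (b ℤ.- a) ℤ.+ x) (ℤₚ.i≡j⇒i-j≡0 (sym (binom-ratio e i))) ⟩
  (+ suc i ℤ.- + suc e) ℤ.* (b ℤ.- a) ℤ.+ + 0
    ≡⟨ ℤₚ.+-identityʳ _ ⟩
  (+ suc i ℤ.- + suc e) ℤ.* (b ℤ.- a)
    ≡⟨ cong ((+ suc i ℤ.- + suc e) ℤ.*_) (binom-suc e i) ⟨
  (+ suc i ℤ.- + suc e) ℤ.* binom (suc e) (suc i) ∎
  where
  open ≡-Reasoning
  a = binom e i
  b = binom e (suc i)
  c = binom e (suc (suc i))
  expand : ∀ s c b → s ℤ.* (c ℤ.- b) ≡ s ℤ.* c ℤ.- s ℤ.* b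
  expand = solve-∀
  collect : ∀ i e a b → ((+ 1 ℤ.+ i) ℤ.- e) ℤ.* b ℤ.- (+ 1 ℤ.+ (+ 1 ℤ.+ i)) ℤ.* b
    ≡ ((+ 1 ℤ.+ i) ℤ.- (+ 1 ℤ.+ e)) ℤ.* (b ℤ.- a) ℤ.+ ((i ℤ.- e) ℤ.* a ℤ.- (+ 1 ℤ.+ i) ℤ.* b)
  collect = solve-∀

-- Pascal's rule combined with `binom-ratio`. For e + 1 a power of p, the right side exhibits that
-- power as a factor.
binom-absorb : ∀ e i → + suc i ℤ.* binom (suc e) (suc i) ≡ ℤ.- + suc e ℤ.* binom e i
binom-absorb e i = begin
  + suc i ℤ.* binom (suc e) (suc i)
    ≡⟨ cong (+ suc i ℤ.*_) (binom-suc e i) ⟩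
  + suc i ℤ.* (b ℤ.- a)
    ≡⟨ expand (+ suc i) b a ⟩
  + suc i ℤ.* b ℤ.- + suc i ℤ.* a
    ≡⟨ cong (ℤ._- + suc i ℤ.* a) (binom-ratio e i) ⟩
  (+ i ℤ.- + e) ℤ.* a ℤ.- (+ 1 ℤ.+ + i) ℤ.* a
    ≡⟨ collect (+ i) (+ e) a ⟩
  ℤ.- + suc e ℤ.* a ∎
  where
  open ≡-Reasoning
  a = binom e i
  b = binom e (suc i)
  expand : ∀ s c b → s ℤ.* (c ℤ.- b) ≡ s ℤ.* c ℤ.- s ℤ.* b
  expand = solve-∀
  collect : ∀ i e a → (i ℤ.- e) ℤ.* a ℤ.- (+ 1 ℤ.+ i) ℤ.* a ≡ ℤ.- (+ 1 ℤ.+ e) ℤ.* a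
  collect = solve-∀

∣binom∣-ratio : ∀ e i → suc i * ∣ binom e (suc i) ∣ ≡ ∣ + i ℤ.- + e ∣ * ∣ binom e i ∣
∣binom∣-ratio e i = trans (sym (ℤₚ.abs-* (+ suc i) (binom e (suc i))))
  (trans (cong ∣_∣ (binom-ratio e i)) (ℤₚ.abs-* (+ i ℤ.- + e) (binom e i)))

∣binom∣-absorb : ∀ e i → suc i * ∣ binom (suc e) (suc i) ∣ ≡ suc e * ∣ binom e i ∣
∣binom∣-absorb e i = trans (sym (ℤₚ.abs-* (+ suc i) (binom (suc e) (suc i))))
  (trans (cong ∣_∣ (binom-absorb e i)) (ℤₚ.abs-* (ℤ.- + suc e) (binom e i)))

-- The numbers n - e and e + t add up to P, so a divisor of P divides both or neither; the converse
-- direction comes next.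
∣n-e∣∣e+t : ∀ {q n t P} e → n + t ≡ P → q ∣ℕ P → q ∣ℕ ∣ + n ℤ.- + e ∣ → q ∣ℕ e + t
∣n-e∣∣e+t {q} {n} {t} e refl q∣P q∣n-e = ∣⇒∣ᵤ {+ q} (subst (+ q ∣ₛ_) (regroup (+ n) (+ t) (+ e))
  (∣m∣n⇒∣m-n (∣ᵤ⇒∣ {+ q} {+ (n + t)} q∣P) (∣ᵤ⇒∣ {+ q} {+ n ℤ.- + e} q∣n-e)))
  where
  regroup : ∀ n t e → (n ℤ.+ t) ℤ.- (n ℤ.- e) ≡ e ℤ.+ t
  regroup = solve-∀

e+t∣∣n-e∣ : ∀ {q n t P} e → n + t ≡ P → q ∣ℕ P → q ∣ℕ e + t → q ∣ℕ ∣ + n ℤ.- + e ∣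
e+t∣∣n-e∣ {q} {n} {t} e refl q∣P q∣e+t = ∣⇒∣ᵤ {+ q} (subst (+ q ∣ₛ_) (regroup (+ n) (+ t) (+ e))
  (∣m∣n⇒∣m-n (∣ᵤ⇒∣ {+ q} {+ (n + t)} q∣P) (∣ᵤ⇒∣ {+ q} {+ (e + t)} q∣e+t)))
  where
  regroup : ∀ n t e → (n ℤ.+ t) ℤ.- (e ℤ.+ t) ≡ n ℤ.- e
  regroup = solve-∀

-- Prime powers dividing binomial coefficients

module _ {p : ℕ} (pr : Prime p) where

  private instance
    p≢0 : NonZero p
    p≢0 = prime⇒nonZero pr

  cancel-unit : ∀ {x} → ¬ p ∣ℕ x → ∀ k {y} → p ^ k ∣ℕ x * y → p ^ k ∣ℕ y
  cancel-unit p∤x zero _ = ℕᵈ.1∣ _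
  cancel-unit {x} p∤x (suc k) {y} p^∣xy
    with euclidsLemma x y pr (ℕᵈ.∣-trans (ℕᵈ.m∣m*n (p ^ k)) p^∣xy)
  ... | inj₁ p∣x = contradiction p∣x p∤x
  ... | inj₂ (divides-refl y′) = subst (p * p ^ k ∣ℕ_) (ℕₚ.*-comm p y′)
    (ℕᵈ.*-monoʳ-∣ p (cancel-unit p∤x k (ℕᵈ.*-cancelˡ-∣ p (subst (p * p ^ k ∣ℕ_) (begin
      x * (y′ * p)  ≡⟨ ℕₚ.*-assoc x y′ p ⟨
      x * y′ * p    ≡⟨ ℕₚ.*-comm (x * y′) p ⟩
      p * (x * y′)  ∎) p^∣xy))))
    where open ≡-Reasoning

  -- A nonzero i below p^b has fewer than b factors p. They are stripped off one at a time, each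
  -- lowering b by one.
  cancel-small : ∀ {a} b {i c} .{{_ : NonZero i}} → i < p ^ b → p ^ (b + a) ∣ℕ i * c → p ^ a ∣ℕ c
  cancel-small zero {suc i} (s≤s ()) _
  cancel-small {a} (suc b) {i} {c} i<p^b p^∣ic with p ∣? i
  ... | no p∤i = ℕᵈ.∣-trans (subst (p ^ a ∣ℕ_) (sym (ℕₚ.^-distribˡ-+-* p (suc b) a)) (ℕᵈ.n∣m*n (p ^ suc b)))
                   (cancel-unit p∤i (suc b + a) p^∣ic)
  ... | yes (divides-refl i′) = cancel-small b {i′} {{ℕₚ.m*n≢0⇒m≢0 i′}}
    (ℕₚ.*-cancelˡ-< p i′ (p ^ b) (subst (_< p * p ^ b) (ℕₚ.*-comm i′ p) i<p^b))
    (ℕᵈ.*-cancelˡ-∣ p (subst (p ^ suc (b + a) ∣ℕ_) (trans (cong (_* c) (ℕₚ.*-comm i′ p)) (ℕₚ.*-assoc p i′ c)) p^∣ic))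

  n<p^n : ∀ n → n < p ^ n
  n<p^n zero = s≤s z≤n
  n<p^n (suc n) = ℕₚ.<-≤-trans (s≤s (n<p^n n)) (begin
    suc (p ^ n)     ≤⟨ ℕₚ.+-monoˡ-≤ (p ^ n) (ℕₚ.m^n>0 p n) ⟩
    p ^ n + p ^ n   ≡⟨ cong (λ x → p ^ n + x) (ℕₚ.+-identityʳ _) ⟨
    2 * p ^ n       ≤⟨ ℕₚ.*-monoˡ-≤ (p ^ n) (ℕ.nonTrivial⇒n>1 p {{prime⇒nonTrivial pr}}) ⟩
    p * p ^ n       ∎)
    where open ℕₚ.≤-Reasoning

  -- By absorption p^(b + a) divides (i + 1) times the coefficient, and i + 1 ≤ b < p^b removes at
  -- most b factors p. This yields (1 - q)^e = 1 modulo p^a and q^(b + 1).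
  p^a∣binom : ∀ {e} a b {i} → e ≡ p ^ (b + a) → i < b → p ^ a ∣ℕ ∣ binom e (suc i) ∣
  p^a∣binom {zero} a b e≡ i<b = contradiction (sym e≡) (ℕ.≢-nonZero⁻¹ _ {{ℕₚ.m^n≢0 p (b + a)}})
  p^a∣binom {suc e} a b {i} e≡ i<b = cancel-small b {suc i} (ℕₚ.≤-<-trans i<b (n<p^n b)) (subst (_∣ℕ suc i * ∣ binom (suc e) (suc i) ∣) e≡
    (subst (suc e ∣ℕ_) (sym (∣binom∣-absorb e i)) (ℕᵈ.m∣m*n _)))

  record Defect (e t : ℕ) : Set where
    constructor defect
    field
      {site} : ℕ
      site>0 : 0 < site
      site≤t : site ≤ t
      p∣     : p ∣ℕ e + site

  -- Divisibility by p^k is carried down from index P to index P - t, at the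
  -- cost of a single factor p if p divides one of e + 1, …, e + t.
  Divisible : ℕ → ℕ → ℕ → ℕ → Set
  Divisible k e t y = p ^ k ∣ℕ y ⊎ (p ^ k ∣ℕ p * y × Defect e t)

  defect-mono : ∀ {e t} → Defect e t → Defect e (suc t)
  defect-mono (defect pos le d) = defect pos (ℕₚ.m≤n⇒m≤1+n le) d

  -- Two multiples of p among e + 1, ..., e + t + 1 would differ by less than p.
  defect-unique : ∀ {e t} → suc t < p → Defect e t → ¬ p ∣ℕ e + suc t
  defect-unique {e} {t} t<p (defect {s} pos le d) d′ = ℕₚ.<⇒≱ t<p (ℕₚ.≤-trans (ℕᵈ.∣⇒≤ {{gap>0}} gap) (ℕₚ.m∸n≤m (suc t) s))
    where
    gap>0 : NonZero (suc t ∸ s)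
    gap>0 = ℕ.>-nonZero (ℕₚ.m<n⇒0<n∸m (s≤s le))
    gap : p ∣ℕ suc t ∸ s
    gap = ℕᵈ.∣m+n∣m⇒∣n (subst (p ∣ℕ_) (sym (trans (ℕₚ.+-assoc e s _)
      (cong (λ x → e + x) (ℕₚ.m+[n∸m]≡n (ℕₚ.m≤n⇒m≤1+n le))))) d′) d

  -- By `binom-ratio` the passage from n + 1 to n divides by n - e, which is -(e + t + 1) modulo P.
  -- Prime to p, it cancels. Otherwise this is the only defect, and `nosq` limits the loss to one
  -- factor p.
  descend-step : ∀ k {e n t P} → p ^ suc k ∣ℕ P → n + suc t ≡ P → suc t < p →
    (p ∣ℕ e + suc t → ¬ p * p ∣ℕ e + suc t) →
    Divisible (suc k) e t (suc n * ∣ binom e (suc n) ∣) → Divisible (suc k) e (suc t) ∣ binom e n ∣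
  descend-step k {e} {n} {t} {P} p^k∣P eq t<p nosq div with p ∣? e + suc t
  ... | no p∤ with div
  ...   | inj₁ d = inj₁ (cancel-unit (λ p∣ → p∤ (∣n-e∣∣e+t e eq (ℕᵈ.∣-trans (ℕᵈ.m∣m*n (p ^ k)) p^k∣P) p∣)) (suc k)
                     (subst (p ^ suc k ∣ℕ_) (∣binom∣-ratio e n) d))
  ...   | inj₂ (d , df) = inj₂ (cancel-unit (λ p∣ → p∤ (∣n-e∣∣e+t e eq (ℕᵈ.∣-trans (ℕᵈ.m∣m*n (p ^ k)) p^k∣P) p∣)) (suc k)
                     (subst (p ^ suc k ∣ℕ_) (trans (cong (p *_) (∣binom∣-ratio e n)) (x∙yz≈y∙xz p ∣ + n ℤ.- + e ∣ ∣ binom e n ∣)) d)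
                     , defect-mono df)
  descend-step k {e} {n} {t} {P} p^k∣P eq t<p nosq div | yes p∣ with div
  ...   | inj₂ (_ , df) = contradiction p∣ (defect-unique t<p df)
  ...   | inj₁ d = inj₂ (lost k p^k∣P d , defect (s≤s z≤n) ℕₚ.≤-refl p∣)
    where
    lost : ∀ k → p ^ suc k ∣ℕ P → p ^ suc k ∣ℕ suc n * ∣ binom e (suc n) ∣ → p ^ suc k ∣ℕ p * ∣ binom e n ∣
    -- For exponent one, P need not be divisible by p², so nothing bounds the power of p in n - e;
    -- but the claim is then merely that p divides p y.
    lost zero _ _ = ℕᵈ.*-monoʳ-∣ p (ℕᵈ.1∣ _)
    lost (suc k) p^k∣P d with e+t∣∣n-e∣ e eq (ℕᵈ.∣-trans (ℕᵈ.m∣m*n (p ^ suc k)) p^k∣P) p∣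
    ... | divides u ∣n-e∣≡up = cancel-unit p∤u (suc (suc k)) (subst (p ^ suc (suc k) ∣ℕ_)
      (trans (∣binom∣-ratio e n) (trans (cong (_* ∣ binom e n ∣) ∣n-e∣≡up) (ℕₚ.*-assoc u p _))) d)
      where
      p∤u : ¬ p ∣ℕ u
      p∤u p∣u = nosq p∣ (∣n-e∣∣e+t e eq (ℕᵈ.∣-trans (divides (p ^ k) (trans (sym (ℕₚ.*-assoc p p _)) (ℕₚ.*-comm (p * p) _))) p^k∣P)
        (subst (p * p ∣ℕ_) (sym ∣n-e∣≡up) (ℕᵈ.*-monoˡ-∣ p p∣u)))

  descend : ∀ k {e P} → p ^ suc k ∣ℕ P → ∀ t n → n + suc t ≡ P → suc t < p →
    (∀ s → 0 < s → s ≤ suc t → p ∣ℕ e + s → ¬ p * p ∣ℕ e + s) → Divisible (suc k) e (suc t) ∣ binom e n ∣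
  descend k {e} {P} p^k∣P zero n eq 1<p nosq =
    descend-step k p^k∣P eq 1<p (nosq 1 (s≤s z≤n) ℕₚ.≤-refl)
      -- The descent starts without any knowledge of `binom e P`: its factor `suc n` is P itself.
      (inj₁ (ℕᵈ.∣-trans p^k∣P (subst (_∣ℕ suc n * ∣ binom e (suc n) ∣) (trans (ℕₚ.+-comm 1 n) eq) (ℕᵈ.m∣m*n _))))
  descend k {e} {P} p^k∣P (suc t) n eq t<p nosq =
    descend-step k p^k∣P eq t<p (nosq _ (s≤s z≤n) ℕₚ.≤-refl)
      (scale (descend k p^k∣P t (suc n) (trans (sym (ℕₚ.+-suc n (suc t))) eq) (ℕₚ.<-trans (ℕₚ.n<1+n _) t<p)
        (λ s pos le → nosq s pos (ℕₚ.m≤n⇒m≤1+n le))))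
    where
    scale : ∀ {y} → Divisible (suc k) e (suc t) y → Divisible (suc k) e (suc t) (suc n * y)
    scale (inj₁ d) = inj₁ (ℕᵈ.∣n⇒∣m*n (suc n) d)
    scale {y} (inj₂ (d , df)) = inj₂ (subst (p ^ suc k ∣ℕ_) (x∙yz≈y∙xz (suc n) p y) (ℕᵈ.∣n⇒∣m*n (suc n) d) , df)

-- Pentagonal exponents

square-pent₁ : ∀ k → (1 + 6 * k) * (1 + 6 * k) ≡ 1 + 24 * pent₁ k
square-pent₁ k = begin
  (1 + 6 * k) * (1 + 6 * k)
    ≡⟨ ℕ-solve 1 (λ k → (ℕ-con 1 ⊕ ℕ-con 6 ⊗ k) ⊗ (ℕ-con 1 ⊕ ℕ-con 6 ⊗ k)
         ⊜ ℕ-con 1 ⊕ ℕ-con 12 ⊗ (k ⊗ (ℕ-con 1 ⊕ ℕ-con 3 ⊗ k))) refl k ⟩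
  1 + 12 * (k * (1 + 3 * k))
    ≡⟨ cong (λ x → 1 + 12 * x) (double-pent₁ k) ⟨
  1 + 12 * (pent₁ k + pent₁ k)
    ≡⟨ ℕ-solve 1 (λ x → ℕ-con 1 ⊕ ℕ-con 12 ⊗ (x ⊕ x) ⊜ ℕ-con 1 ⊕ ℕ-con 24 ⊗ x) refl (pent₁ k) ⟩
  1 + 24 * pent₁ k ∎
  where open ≡-Reasoning

square-pent₅ : ∀ k → (5 + 6 * k) * (5 + 6 * k) ≡ 1 + 24 * pent₅ k
square-pent₅ k = begin
  (5 + 6 * k) * (5 + 6 * k)
    ≡⟨ ℕ-solve 1 (λ k → (ℕ-con 5 ⊕ ℕ-con 6 ⊗ k) ⊗ (ℕ-con 5 ⊕ ℕ-con 6 ⊗ k)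
         ⊜ (ℕ-con 1 ⊕ ℕ-con 6 ⊗ k) ⊗ (ℕ-con 1 ⊕ ℕ-con 6 ⊗ k) ⊕ ℕ-con 24 ⊗ (ℕ-con 1 ⊕ (k ⊕ k))) refl k ⟩
  (1 + 6 * k) * (1 + 6 * k) + 24 * suc (k + k)
    ≡⟨ cong (_+ 24 * suc (k + k)) (square-pent₁ k) ⟩
  1 + 24 * pent₁ k + 24 * suc (k + k)
    ≡⟨ ℕ-solve 2 (λ k x → ℕ-con 1 ⊕ ℕ-con 24 ⊗ x ⊕ ℕ-con 24 ⊗ (ℕ-con 1 ⊕ (k ⊕ k))
         ⊜ ℕ-con 1 ⊕ ℕ-con 24 ⊗ ((ℕ-con 1 ⊕ (k ⊕ k)) ⊕ x)) refl k (pent₁ k) ⟩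
  1 + 24 * pent₅ k ∎
  where open ≡-Reasoning

-- The index is -k here and k + 1 in `pent₅-pentagonal`.
pent₁-pentagonal : ∀ k → ∃ λ ν → pent ν ≡ pent₁ k
pent₁-pentagonal zero = + 0 , refl
pent₁-pentagonal (suc k) = -[1+ k ] , (begin
  ⌊ suc k * (3 * suc k + 1) /2⌋   ≡⟨ cong (λ x → ⌊ suc k * x /2⌋) (ℕₚ.+-comm (3 * suc k) 1) ⟩
  ⌊ suc k * (1 + 3 * suc k) /2⌋   ≡⟨ cong ⌊_/2⌋ (double-pent₁ (suc k)) ⟨
  ⌊ pent₁ (suc k) + pent₁ (suc k) /2⌋     ≡⟨ ℕₚ.n≡⌊n+n/2⌋ (pent₁ (suc k)) ⟨
  pent₁ (suc k)                       ∎)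
  where open ≡-Reasoning

pent₅-pentagonal : ∀ k → ∃ λ ν → pent ν ≡ pent₅ k
pent₅-pentagonal k = + suc k , (begin
  ⌊ suc k * (3 * suc k ∸ 1) /2⌋   ≡⟨ cong ⌊_/2⌋ double ⟩
  ⌊ pent₅ k + pent₅ k /2⌋               ≡⟨ ℕₚ.n≡⌊n+n/2⌋ (pent₅ k) ⟨
  pent₅ k                            ∎)
  where
  open ≡-Reasoning
  double : suc k * (3 * suc k ∸ 1) ≡ pent₅ k + pent₅ k
  double = begin
    suc k * (3 * suc k ∸ 1)
      -- The second factor on the left is the form to which `3 * suc k ∸ 1` computes.
      ≡⟨ ℕ-solve 1 (λ k → (ℕ-con 1 ⊕ k) ⊗ (k ⊕ ((ℕ-con 1 ⊕ k) ⊕ ((ℕ-con 1 ⊕ k) ⊕ ℕ-con 0)))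
           ⊜ ℕ-con 2 ⊗ (ℕ-con 1 ⊕ (k ⊕ k)) ⊕ k ⊗ (ℕ-con 1 ⊕ ℕ-con 3 ⊗ k)) refl k ⟩
    2 * suc (k + k) + k * (1 + 3 * k)
      ≡⟨ cong (λ x → 2 * suc (k + k) + x) (double-pent₁ k) ⟨
    2 * suc (k + k) + (pent₁ k + pent₁ k)
      ≡⟨ ℕ-solve 2 (λ k x → ℕ-con 2 ⊗ (ℕ-con 1 ⊕ (k ⊕ k)) ⊕ (x ⊕ x)
           ⊜ ((ℕ-con 1 ⊕ (k ⊕ k)) ⊕ x) ⊕ ((ℕ-con 1 ⊕ (k ⊕ k)) ⊕ x)) refl k (pent₁ k) ⟩
    pent₅ k + pent₅ k ∎

Odd : ℕ → Set
Odd n = ∃ λ h → n ≡ suc (h + h)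

odd-^ : ∀ {n} → Odd n → ∀ s → Odd (n ^ s)
odd-^ odd zero = 0 , refl
odd-^ {n} (a , refl) (suc s) with odd-^ (a , refl) s
... | b , eq rewrite eq = a + b + (a * b + a * b) ,
  ℕ-solve 2 (λ a b → (ℕ-con 1 ⊕ (a ⊕ a)) ⊗ (ℕ-con 1 ⊕ (b ⊕ b))
    ⊜ ℕ-con 1 ⊕ ((a ⊕ b ⊕ (a ⊗ b ⊕ a ⊗ b)) ⊕ (a ⊕ b ⊕ (a ⊗ b ⊕ a ⊗ b)))) refl a b

-- Residues of pentagonal numbers modulo p

module _ {p : ℕ} (pr : Prime p) (5≤p : 5 ≤ p) where

  private instance
    p≢0 : NonZero p
    p≢0 = prime⇒nonZero pr

  not-divisor : ∀ d → 1 < d → d < 5 → ¬ d ∣ℕ p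
  not-divisor d 1<d d<5 d∣p with prime⇒irreducible pr d∣p
  ... | inj₁ refl = ℕₚ.<-irrefl refl 1<d
  ... | inj₂ refl = ℕₚ.<⇒≱ d<5 5≤p

  -- The other residues share a factor 2 or 3 with p. Both surviving forms are odd, and they are
  -- roots to which `square-pent₁` or `square-pent₅` applies, so p² is 1 modulo 24.
  prime-mod-6 : ∃ λ l → p ≡ 1 + 6 * l ⊎ p ≡ 5 + 6 * l
  prime-mod-6 = p / 6 , cases (p % 6) (m%n<n p 6) (trans (m≡m%n+[m/n]*n p 6) (cong (λ x → p % 6 + x) (ℕₚ.*-comm (p / 6) 6)))
    where
    l = p / 6
    2∣6l : 2 ∣ℕ 6 * l
    2∣6l = ℕᵈ.∣m⇒∣m*n l (divides 3 refl)
    3∣6l : 3 ∣ℕ 6 * l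
    3∣6l = ℕᵈ.∣m⇒∣m*n l (divides 2 refl)
    not-2 : ∀ r → 2 ∣ℕ r → p ≢ r + 6 * l
    not-2 r 2∣r eq = not-divisor 2 (s≤s (s≤s z≤n)) (s≤s (s≤s (s≤s z≤n))) (subst (2 ∣ℕ_) (sym eq) (ℕᵈ.∣m∣n⇒∣m+n 2∣r 2∣6l))
    not-3 : ∀ r → 3 ∣ℕ r → p ≢ r + 6 * l
    not-3 r 3∣r eq = not-divisor 3 (s≤s (s≤s z≤n)) (s≤s (s≤s (s≤s (s≤s z≤n)))) (subst (3 ∣ℕ_) (sym eq) (ℕᵈ.∣m∣n⇒∣m+n 3∣r 3∣6l))
    cases : ∀ r → r < 6 → p ≡ r + 6 * l → p ≡ 1 + 6 * l ⊎ p ≡ 5 + 6 * l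
    cases 0 _ eq = contradiction eq (not-2 0 (divides 0 refl))
    cases 1 _ eq = inj₁ eq
    cases 2 _ eq = contradiction eq (not-2 2 (divides 1 refl))
    cases 3 _ eq = contradiction eq (not-3 3 (divides 1 refl))
    cases 4 _ eq = contradiction eq (not-2 4 (divides 2 refl))
    cases 5 _ eq = inj₂ eq
    cases (suc (suc (suc (suc (suc (suc _)))))) (s≤s (s≤s (s≤s (s≤s (s≤s (s≤s ())))))) _

  prime-odd : Odd p
  prime-odd with prime-mod-6
  ... | l , inj₁ eq = 3 * l , trans eq (ℕ-solve 1 (λ l → ℕ-con 1 ⊕ ℕ-con 6 ⊗ l ⊜ ℕ-con 1 ⊕ (ℕ-con 3 ⊗ l ⊕ ℕ-con 3 ⊗ l)) refl l)
  ... | l , inj₂ eq = 2 + 3 * l , trans eq (ℕ-solve 1 (λ l → ℕ-con 5 ⊕ ℕ-con 6 ⊗ l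
    ⊜ ℕ-con 1 ⊕ ((ℕ-con 2 ⊕ ℕ-con 3 ⊗ l) ⊕ (ℕ-con 2 ⊕ ℕ-con 3 ⊗ l))) refl l)

  prime-square : ∃ λ r → p * p ≡ 1 + 24 * r
  prime-square with prime-mod-6
  ... | l , inj₁ refl = pent₁ l , square-pent₁ l
  ... | l , inj₂ refl = pent₅ l , square-pent₅ l

  -- If p² | 24e + 1 and p² | e + s, then 24s = f p² + 1 with f ≡ -1 (mod 24), so f ≥ 23.
  no-square : ∀ {e s} → p * p ∣ℕ 1 + 24 * e → 0 < s → s < p → ¬ p * p ∣ℕ e + s
  no-square {e} {s} (divides b 1+24e≡bp²) 0<s s<p (divides c e+s≡cp²) with prime-square
  ... | r , p²≡1+24r = ℕₚ.<⇒≱ 24s<23p² 23p²≤24s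
    where
    open ℕₚ.≤-Reasoning
    balance : 24 * s + b * (p * p) ≡ 1 + 24 * c * (p * p)
    balance = begin-equality
      24 * s + b * (p * p)      ≡⟨ cong (λ x → 24 * s + x) 1+24e≡bp² ⟨
      24 * s + (1 + 24 * e)     ≡⟨ ℕ-solve 2 (λ e s → ℕ-con 24 ⊗ s ⊕ (ℕ-con 1 ⊕ ℕ-con 24 ⊗ e) ⊜ ℕ-con 1 ⊕ ℕ-con 24 ⊗ (e ⊕ s)) refl e s ⟩
      1 + 24 * (e + s)          ≡⟨ cong (λ x → 1 + 24 * x) e+s≡cp² ⟩
      1 + 24 * (c * (p * p))    ≡⟨ cong suc (ℕₚ.*-assoc 24 c (p * p)) ⟨
      1 + 24 * c * (p * p)      ∎
    1<24s : 1 < 24 * s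
    1<24s = ℕₚ.<-≤-trans (s≤s (s≤s z≤n)) (ℕₚ.*-monoʳ-≤ 24 0<s)
    b≤24c : b ≤ 24 * c
    b≤24c = ℕₚ.*-cancelʳ-≤ b (24 * c) (p * p) {{ℕₚ.m*n≢0 p p}} (ℕₚ.+-cancelˡ-≤ 1 _ _ (begin
      1 + b * (p * p)       ≤⟨ ℕₚ.+-monoˡ-≤ (b * (p * p)) (ℕₚ.<⇒≤ 1<24s) ⟩
      24 * s + b * (p * p)  ≡⟨ balance ⟩
      1 + 24 * c * (p * p)  ∎))
    f = 24 * c ∸ b
    24s≡ : 24 * s ≡ 1 + f * (p * p)
    24s≡ = ℕₚ.+-cancelʳ-≡ (b * (p * p)) _ _ (begin-equality
      24 * s + b * (p * p)              ≡⟨ balance ⟩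
      1 + 24 * c * (p * p)              ≡⟨ cong (λ x → 1 + x * (p * p)) (ℕₚ.m∸n+n≡m b≤24c) ⟨
      1 + (f + b) * (p * p)             ≡⟨ cong suc (ℕₚ.*-distribʳ-+ (p * p) f b) ⟩
      1 + f * (p * p) + b * (p * p)     ∎)
    -- As p² is 1 modulo 24, the number 24 s = 1 + f p² is congruent to 1 + f.
    24∣1+f : 24 ∣ℕ suc f
    24∣1+f = ℕᵈ.∣m+n∣m⇒∣n (subst (24 ∣ℕ_) (begin-equality
      24 * s                       ≡⟨ 24s≡ ⟩
      1 + f * (p * p)              ≡⟨ cong (λ x → 1 + f * x) p²≡1+24r ⟩
      1 + f * (1 + 24 * r)         ≡⟨ ℕ-solve 2 (λ f r → ℕ-con 1 ⊕ f ⊗ (ℕ-con 1 ⊕ ℕ-con 24 ⊗ r) ⊜ ℕ-con 24 ⊗ (f ⊗ r) ⊕ (ℕ-con 1 ⊕ f)) refl f r ⟩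
      24 * (f * r) + suc f         ∎) (ℕᵈ.m∣m*n s)) (ℕᵈ.m∣m*n (f * r))
    23p²≤24s : 23 * (p * p) ≤ 24 * s
    23p²≤24s = begin
      23 * (p * p)       ≤⟨ ℕₚ.*-monoˡ-≤ (p * p) (ℕₚ.≤-pred (ℕᵈ.∣⇒≤ 24∣1+f)) ⟩
      f * (p * p)        ≤⟨ ℕₚ.n≤1+n _ ⟩
      1 + f * (p * p)    ≡⟨ 24s≡ ⟨
      24 * s             ∎
    24s<23p² : 24 * s < 23 * (p * p)
    24s<23p² = begin-strict
      24 * s           <⟨ ℕₚ.*-monoʳ-< 24 s<p ⟩
      -- Uses 24 + 91 = 115 = 23 · 5 ≤ 23 p.
      24 * p           ≤⟨ ℕₚ.*-monoˡ-≤ p (ℕₚ.≤-trans (ℕₚ.m≤m+n 24 91) (ℕₚ.*-monoʳ-≤ 23 5≤p)) ⟩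
      23 * p * p       ≡⟨ ℕₚ.*-assoc 23 p p ⟩
      23 * (p * p)     ∎

  InS-pent : ∀ {e} → (∃ λ ν → pent ν ≡ e) → InS p (e % p)
  InS-pent {e} (ν , refl) = m%n<n e p , ν , divides (e / p) (begin
    ∣ + (e % p) ℤ.- + e ∣
      ≡⟨ cong (λ x → ∣ + (e % p) ℤ.- + x ∣) (m≡m%n+[m/n]*n e p) ⟩
    ∣ + (e % p) ℤ.- + (e % p + e / p * p) ∣
      ≡⟨ cong ∣_∣ (cancel (+ (e % p)) (+ (e / p * p))) ⟩
    ∣ ℤ.- + (e / p * p) ∣
      ≡⟨ ℤₚ.∣-i∣≡∣i∣ (+ (e / p * p)) ⟩
    e / p * p ∎)
    where
    open ≡-Reasoning
    cancel : ∀ r q → r ℤ.- (r ℤ.+ q) ≡ ℤ.- q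
    cancel = solve-∀

  module _ {i₀ : ℕ} (p∣24i₀+1 : p ∣ℕ 24 * i₀ + 1) {j : ℕ} (1≤j : 1 ≤ j)
           (j-bound : ∀ s → InS p s → s ≢ i₀ → j ≤ p ∸ 1 ∸ s) where

    -- The residue 0 is pentagonal and differs from i₀, since p does not divide 1; the bound at 0
    -- gives j ≤ p - 1.
    j<p : j < p
    j<p = ℕₚ.≤-<-trans (j-bound 0 (ℕₚ.<-≤-trans (s≤s z≤n) 5≤p , + 0 , divides 0 refl) 0≢i₀)
            (ℕₚ.≤-reflexive (ℕₚ.suc-pred p))
      where
      0≢i₀ : 0 ≢ i₀
      0≢i₀ refl = ℕₚ.<⇒≱ (ℕₚ.<-≤-trans (s≤s (s≤s z≤n)) 5≤p) (ℕᵈ.∣⇒≤ p∣24i₀+1)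

    %-split : ∀ e s → e + s ≡ e / p * p + (e % p + s)
    %-split e s = trans (cong (_+ s) (trans (m≡m%n+[m/n]*n e p) (ℕₚ.+-comm (e % p) _))) (ℕₚ.+-assoc _ (e % p) s)

    -- The bound on j at the residue of e keeps e % p + s strictly between 0 and p.
    outside-i₀ : ∀ {e s} → (∃ λ ν → pent ν ≡ e) → e % p ≢ i₀ → 0 < s → s ≤ j → ¬ p ∣ℕ e + s
    outside-i₀ {e} {s} pe ≢i₀ 0<s s≤j p∣e+s = ℕₚ.<⇒≱ small
      (ℕᵈ.∣⇒≤ {{ℕ.>-nonZero (ℕₚ.<-≤-trans 0<s (ℕₚ.m≤n+m s (e % p)))}}
        (ℕᵈ.∣m+n∣m⇒∣n (subst (p ∣ℕ_) (%-split e s) p∣e+s) (ℕᵈ.n∣m*n (e / p))))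
      where
      open ℕₚ.≤-Reasoning
      small : e % p + s < p
      small = begin-strict
        e % p + s                ≤⟨ ℕₚ.+-monoʳ-≤ (e % p) (ℕₚ.≤-trans s≤j (j-bound (e % p) (InS-pent pe) ≢i₀)) ⟩
        e % p + (p ∸ 1 ∸ e % p)  ≡⟨ ℕₚ.m+[n∸m]≡n (ℕₚ.<⇒≤pred (m%n<n e p)) ⟩
        p ∸ 1                    <⟨ ℕₚ.≤-reflexive (ℕₚ.suc-pred p) ⟩
        p                        ∎

    -- Here 24 e + 1 is 24 i₀ + 1 modulo p, so p divides a².
    at-i₀ : ∀ {a e} → a * a ≡ 1 + 24 * e → e % p ≡ i₀ → p ∣ℕ a
    at-i₀ {a} {e} a²≡ refl = reduce (euclidsLemma a a pr (subst (p ∣ℕ_) (begin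
      24 * (e / p * p) + (24 * (e % p) + 1)
        ≡⟨ ℕ-solve 2 (λ q r → ℕ-con 24 ⊗ q ⊕ (ℕ-con 24 ⊗ r ⊕ ℕ-con 1) ⊜ ℕ-con 1 ⊕ ℕ-con 24 ⊗ (r ⊕ q)) refl (e / p * p) (e % p) ⟩
      1 + 24 * (e % p + e / p * p)
        ≡⟨ cong (λ x → 1 + 24 * x) (m≡m%n+[m/n]*n e p) ⟨
      1 + 24 * e
        ≡⟨ a²≡ ⟨
      a * a ∎) (ℕᵈ.∣m∣n⇒∣m+n (ℕᵈ.∣n⇒∣m*n 24 (ℕᵈ.n∣m*n (e / p))) p∣24i₀+1)))
      where open ≡-Reasoning

    -- Away from i₀ the descent has no defect. At i₀ the weight a repays the lost factor p, and p²
    -- dividing a² = 24 e + 1 is what `no-square` needs to exclude a larger loss.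
    pentagonal-term : ∀ {k P n a e} → p ^ suc k ∣ℕ P → n + j ≡ P → a * a ≡ 1 + 24 * e →
      (∃ λ ν → pent ν ≡ e) → p ^ suc k ∣ℕ a * ∣ binom e n ∣
    pentagonal-term {k} {P} {n} {a} {e} p^∣P eq a²≡ pe =
      conclude (descended 1≤j eq j<p nosq)
      where
      descended : ∀ {j} → 1 ≤ j → n + j ≡ P → j < p →
        (∀ s → 0 < s → s ≤ j → p ∣ℕ e + s → ¬ p * p ∣ℕ e + s) → Divisible pr (suc k) e j ∣ binom e n ∣
      descended {suc t} _ eq j<p = descend pr k p^∣P t n eq j<p
      nosq : ∀ s → 0 < s → s ≤ j → p ∣ℕ e + s → ¬ p * p ∣ℕ e + s
      nosq s 0<s s≤j p∣e+s with e % p ℕ.≟ i₀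
      ... | no ≢i₀ = contradiction p∣e+s (outside-i₀ pe ≢i₀ 0<s s≤j)
      ... | yes ≡i₀ = no-square (subst (p * p ∣ℕ_) a²≡ (ℕᵈ.*-pres-∣ p∣a p∣a)) 0<s (ℕₚ.≤-<-trans s≤j j<p)
        where
        p∣a : p ∣ℕ a
        p∣a = at-i₀ {a} a²≡ ≡i₀
      conclude : Divisible pr (suc k) e j ∣ binom e n ∣ → p ^ suc k ∣ℕ a * ∣ binom e n ∣
      conclude (inj₁ d) = ℕᵈ.∣n⇒∣m*n a d
      conclude (inj₂ (d , defect 0<s s≤j p∣e+s)) with e % p ℕ.≟ i₀
      ... | no ≢i₀ = contradiction p∣e+s (outside-i₀ pe ≢i₀ 0<s s≤j)
      ... | yes ≡i₀ = ℕᵈ.∣-trans d (ℕᵈ.*-monoˡ-∣ ∣ binom e n ∣ (at-i₀ {a} a²≡ ≡i₀))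

-- Fishburn numbers

-- Every factor 1 - (1 - q)^i has constant term zero and contributes one to the order.
summand-order : ∀ k → OrderAtLeast k (summand k)
summand-order zero i ()
summand-order (suc k) i i<1+k =
  mulP-order k 1 (summand k) _ (summand-order k) factor i (subst (i <_) (ℕₚ.+-comm 1 k) i<1+k)
  where
  factor : OrderAtLeast 1 (subP oneP (powP oneMinusQ (suc k)))
  factor zero _ = trans (coeff-addP oneP (negP (powP oneMinusQ (suc k))) 0)
    (cong (λ x → + 1 ℤ.+ x) (trans (coeff-negP (powP oneMinusQ (suc k)) 0) (cong ℤ.-_ (binom-zero (suc k)))))
  factor (suc i) (s≤s ())

coeff-partialSum : ∀ n d → coeff n (partialSum (d + n)) ≡ ξ n
coeff-partialSum n zero = refl
coeff-partialSum n (suc d) = begin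
  coeff n (addP (partialSum (d + n)) (summand (suc (d + n))))
    ≡⟨ coeff-addP (partialSum (d + n)) _ n ⟩
  coeff n (partialSum (d + n)) ℤ.+ coeff n (summand (suc (d + n)))
    ≡⟨ cong₂ ℤ._+_ (coeff-partialSum n d) (summand-order (suc (d + n)) n (s≤s (ℕₚ.m≤n+m n d))) ⟩
  ξ n ℤ.+ + 0
    ≡⟨ ℤₚ.+-identityʳ (ξ n) ⟩
  ξ n ∎
  where open ≡-Reasoning

module Fishburn (d : ℤ) (N : ℕ) where
  open Truncated d N
  open CommutativeRing commutativeRing using (*-cong; +-cong; +-congˡ; -‿cong; *-identityʳ; semiring)
    renaming (refl to ≈-refl; reflexive to ≈-reflexive)
  open Algebra.Properties.Semiring.Exp semiring using () renaming (_^_ to _^ᴾ_)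
  open StrangeIdentity commutativeRing constants oneMinusQ

  ^≡powP : ∀ e → oneMinusQ ^ᴾ e ≡ powP oneMinusQ e
  ^≡powP zero = refl
  ^≡powP (suc e) = cong (mulP oneMinusQ) (^≡powP e)

  poch≈summand : ∀ k → poch oneP k ≈ summand k
  poch≈summand zero = ≈-refl
  poch≈summand (suc k) = *-cong (poch≈summand k) (+-congˡ (-‿cong
    (≈-trans (*-identityʳ _) (≈-reflexive (^≡powP (suc k))))))

  -- `F` runs over indices strictly below its argument, whence the shift by one.
  F≈partialSum : ∀ n → F (suc n) ≈ partialSum n
  F≈partialSum zero = ≈-refl
  F≈partialSum (suc n) = +-cong (F≈partialSum n) (poch≈summand (suc n))

  sign-constant : ∀ k → ∃ λ c → sign k ≡ c ∷ []
  sign-constant zero = + 1 , refl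
  sign-constant (suc k) = _ , cong negP (proj₂ (sign-constant k))

  coeff-E : ∀ n → (∀ i → d ∣ₛ + (1 + 6 * i) ℤ.* binom (pent₁ i) n) → (∀ i → d ∣ₛ + (5 + 6 * i) ℤ.* binom (pent₅ i) n) →
            ∀ k → d ∣ₛ coeff n (E k)
  coeff-E n d∣₁ d∣₅ zero = dividesₛ (+ 0) refl
  coeff-E n d∣₁ d∣₅ (suc k) = subst (d ∣ₛ_) (sym (coeff-addP (E k) (mulP (sign k) term) n))
    (∣m∣n⇒∣m+n (coeff-E n d∣₁ d∣₅ k) (subst (d ∣ₛ_) (sym coeff-signed) (∣n⇒∣m*n c d∣term)))
    where
    scaled : ℕ → ℕ → Poly
    scaled a e = mulP (+ a ∷ []) (oneMinusQ ^ᴾ e)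
    term : Poly
    term = addP (scaled (1 + 6 * k) (pent₁ k)) (negP (scaled (5 + 6 * k) (pent₅ k)))
    c : ℤ
    c = proj₁ (sign-constant k)
    coeff-signed : coeff n (mulP (sign k) term) ≡ c ℤ.* coeff n term
    coeff-signed = trans (cong (λ f → coeff n (mulP f term)) (proj₂ (sign-constant k))) (coeff-const-mulP c term n)
    coeff-scaled : ∀ a e → coeff n (scaled a e) ≡ + a ℤ.* binom e n
    coeff-scaled a e = trans (coeff-const-mulP (+ a) (oneMinusQ ^ᴾ e) n) (cong (λ f → + a ℤ.* coeff n f) (^≡powP e))
    d∣term : d ∣ₛ coeff n term
    d∣term = subst (d ∣ₛ_) (sym (trans (coeff-addP (scaled (1 + 6 * k) (pent₁ k)) _ n)
      (cong₂ ℤ._+_ (coeff-scaled (1 + 6 * k) (pent₁ k))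
        (trans (coeff-negP (scaled (5 + 6 * k) (pent₅ k)) n) (cong ℤ.-_ (coeff-scaled (5 + 6 * k) (pent₅ k)))))))
      (∣m∣n⇒∣m-n (d∣₁ k) (d∣₅ k))

-- A shift by q^(n+1) squares to zero modulo q^(2n+2), so it can play the role of u.
ξ-divisible : ∀ (d : ℤ) n h → n ≤ h →
  (∀ i → i ≤ n + suc n → d ∣ₛ binom (suc (h + h)) (suc i)) →
  (∀ i → d ∣ₛ + (1 + 6 * i) ℤ.* binom (pent₁ i) n) → (∀ i → d ∣ₛ + (5 + 6 * i) ℤ.* binom (pent₅ i) n) →
  d ∣ₛ + 4 ℤ.* ξ n
ξ-divisible d n h n≤h d∣binom d∣₁ d∣₅ = subst (λ x → d ∣ₛ + 4 ℤ.* x) coeff-ps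
  (subst (d ∣ₛ_) (replace (coeff n (F (suc L))) (coeff n (partialSum L)))
    (∣m∣n⇒∣m-n d∣4F (∣n⇒∣m*n (+ 4) (coeff-≈ (F≈partialSum L) n (s≤s (ℕₚ.m≤m+n n K))))))
  where
  K = suc n
  open Truncated d (K + K)
  open Fishburn d (K + K)
  open StrangeIdentity commutativeRing constants oneMinusQ
  m = suc (h + h)
  -- Chosen so that `suc L` is m + m, the least number of terms that `strange` admits.
  L = h + h + m
  u = monomial K
  u²≈0 : mulP u u ≈ []
  u²≈0 = mk≈ λ i i<N → subst (d ∣ₛ_) (sym (cong (ℤ._- + 0)
    (mulP-order K K u u (λ _ → coeff-monomial-<) (λ _ → coeff-monomial-<) i i<N))) (dividesₛ (+ 0) refl)
  z^m≈1 : powP oneMinusQ m ≈ oneP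
  z^m≈1 = mk≈ λ where
    zero _ → subst (d ∣ₛ_) (sym (cong (ℤ._- + 1) (binom-zero m))) (dividesₛ (+ 0) refl)
    (suc i) (s≤s i≤) → subst (d ∣ₛ_) (sym (ℤₚ.+-identityʳ _)) (d∣binom i (ℕₚ.<⇒≤ i≤))
  coeff-ps : coeff n (partialSum L) ≡ ξ n
  coeff-ps = trans (cong (λ l → coeff n (partialSum l)) (sym (ℕₚ.m∸n+n≡m n≤L))) (coeff-partialSum n (L ∸ n))
    where
    n≤L : n ≤ L
    n≤L = ℕₚ.≤-trans n≤h (ℕₚ.≤-trans (ℕₚ.m≤m+n h h) (ℕₚ.m≤m+n (h + h) m))
  identity : mulP u (mulP (+ 4 ∷ []) (F (suc L))) ≈ negP (mulP u (E m))
  identity = strange {u} u²≈0 h (≈-trans (≗⇒≈ (λ i → cong (coeff i) (^≡powP m))) z^m≈1) ℕₚ.≤-refl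
  d∣4F : d ∣ₛ + 4 ℤ.* coeff n (F (suc L))
  -- Multiplication by u shifts degrees by K, so u is removed by reading off the coefficient of q^(K
  -- + n), the last degree below the cut-off K + K.
  d∣4F = subst (d ∣ₛ_) (trans (cong (ℤ._- coeff n (E m)) (cong₂ ℤ._-_
      (trans (coeff-monomial-mulP K (mulP (+ 4 ∷ []) (F (suc L))) n) (coeff-const-mulP (+ 4) (F (suc L)) n))
      (trans (coeff-negP (mulP u (E m)) (K + n)) (cong ℤ.-_ (coeff-monomial-mulP K (E m) n)))))
      (drop (+ 4 ℤ.* coeff n (F (suc L))) (coeff n (E m))))
    (∣m∣n⇒∣m-n (coeff-≈ identity (K + n) (ℕₚ.+-monoʳ-< K (ℕₚ.n<1+n n))) (coeff-E n d∣₁ d∣₅ m))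
    where
    drop : ∀ x e → (x ℤ.- (ℤ.- e)) ℤ.- e ≡ x
    drop = solve-∀
  replace : ∀ x y → + 4 ℤ.* x ℤ.- + 4 ℤ.* (x ℤ.- y) ≡ + 4 ℤ.* y
  replace = solve-∀

open import Data.Integer.Divisibility using (_∣_)

theorem2 : (p : ℕ) → Prime p → 5 ≤ p →
    (i₀ : ℕ) → i₀ < p → p ∣ℕ (24 * i₀ + 1) →
    (j : ℕ) → 1 ≤ j →
    ((s : ℕ) → InS p s → s ≢ i₀ → j ≤ p ∸ 1 ∸ s) →
    (m λ′ : ℕ) → 1 ≤ m → 1 ≤ λ′ →
    (+ (p ^ λ′)) ∣ ξ (p ^ λ′ * m ∸ j)
theorem2 p pr 5≤p i₀ _ p∣24i₀+1 j 1≤j j-bound m (suc k) 1≤m _ =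
  -- As p > 4, the factor 4 of the strange identity is prime to p.
  cancel-unit pr (λ p∣4 → ℕₚ.<⇒≱ 5≤p (ℕᵈ.∣⇒≤ p∣4)) (suc k)
    (subst (p ^ suc k ∣ℕ_) (ℤₚ.abs-* (+ 4) (ξ n))
      (∣⇒∣ᵤ {+ (p ^ suc k)} (ξ-divisible (+ (p ^ suc k)) n h n≤h d∣binom
        (λ i → d∣term (1 + 6 * i) (pent₁ i) (square-pent₁ i) (pent₁-pentagonal i))
        (λ i → d∣term (5 + 6 * i) (pent₅ i) (square-pent₅ i) (pent₅-pentagonal i)))))
  where
  instance
    p≢0 : NonZero p
    p≢0 = prime⇒nonZero pr
  P = p ^ suc k * m
  n = P ∸ j
  j≤P : j ≤ P
  j≤P = begin
    j            ≤⟨ ℕₚ.<⇒≤ (j<p pr 5≤p p∣24i₀+1 1≤j j-bound) ⟩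
    p            ≤⟨ ℕₚ.m≤m*n p (p ^ k) {{ℕₚ.m^n≢0 p k}} ⟩
    p ^ suc k    ≤⟨ ℕₚ.m≤m*n (p ^ suc k) m {{ℕ.>-nonZero 1≤m}} ⟩
    P            ∎
    where open ℕₚ.≤-Reasoning
  d∣term : ∀ a e → a * a ≡ 1 + 24 * e → (∃ λ ν → pent ν ≡ e) → + (p ^ suc k) ∣ₛ + a ℤ.* binom e n
  d∣term a e a²≡ pe = ∣ᵤ⇒∣ (subst (p ^ suc k ∣ℕ_) (sym (ℤₚ.abs-* (+ a) (binom e n)))
    (pentagonal-term pr 5≤p p∣24i₀+1 1≤j j-bound {k = k} {a = a} (ℕᵈ.m∣m*n m) (ℕₚ.m∸n+n≡m j≤P) a²≡ pe))
  -- The truncation is at q^(2n + 2). With M = p^(b + k + 1), `p^a∣binom` makes the coefficients of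
  -- z^M in degrees 1 to b divisible by p^(k + 1).
  b = 2 * suc n
  M-odd : Odd (p ^ (b + suc k))
  M-odd = odd-^ (prime-odd pr 5≤p) (b + suc k)
  h = proj₁ M-odd
  n≤h : n ≤ h
  n≤h = ℕₚ.*-cancelˡ-≤ 2 (begin
    2 * n              ≤⟨ ℕₚ.*-monoʳ-≤ 2 (ℕₚ.n≤1+n n) ⟩
    b                  ≤⟨ ℕₚ.m≤m+n b (suc k) ⟩
    b + suc k          ≤⟨ ℕₚ.≤-pred (subst (b + suc k <_) (proj₂ M-odd) (n<p^n pr (b + suc k))) ⟩
    h + h              ≡⟨ cong (λ x → h + x) (ℕₚ.+-identityʳ h) ⟨
    2 * h              ∎)
    where open ℕₚ.≤-Reasoning
  d∣binom : ∀ i → i ≤ n + suc n → + (p ^ suc k) ∣ₛ binom (suc (h + h)) (suc i)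
  d∣binom i i≤ = ∣ᵤ⇒∣ (p^a∣binom pr (suc k) b (sym (proj₂ M-odd)) (s≤s (ℕₚ.≤-trans i≤
    (ℕₚ.≤-reflexive (cong (λ x → n + x) (sym (ℕₚ.+-identityʳ (suc n))))))))
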